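{- Fix $r\in\{0,1\}$ and $n\ge 0$. Let $\pi\in B_n$ be a hyperoctahedral involution with exactly $d$ barred two-cycles. Then the sign of its domino insertion tableau satisfies \[ \mathrm{sign}\big(P_d^r(\pi)\big)=(-1)^{d}. \]
   Context: Partitions are identified with Young diagrams in English notation: cell $(k,l)$ lies in row $k$ (rows numbered $1,2,\dots$ from top to bottom) and column $l$ (columns numbered $1,2,\dots$ from left to right). A domino is a set of two cells sharing an edge; it is vertical if both cells lie in the same column, horizontal otherwise. For $r\ge0$ let $\delta_r=(r,r-1,\dots,1)$ ($\delta_0=\emptyset$). Every partition $\lambda$ has a 2-core $\tilde\lambda$ (obtained by repeatedly removing dominoes whose removal leaves a partition, until impossible), which equals $\delta_r$ for a unique $r$. $\mathcal P_r(n)$ denotes the set of partitions with 2-core $\delta_r$ and size $|\delta_r|+2n$. A standard domino tableau (SDT) of shape $\lambda\in\mathcal P_r(n)$ is a chain of partitions $\delta_r=\lambda^0\subset\lambda^1\subset\cdots\subset\lambda^n=\lambda$ with each $\lambda^k/\lambda^{k-1}$ a domino, called the domino with value $k$. Its spin $sp(D)$ is half the number of vertical dominoes. Signed permutations: $B_n$ is the set of words $\pi=\pi_1\cdots\pi_n$ in letters from $\{1,\dots,n,\bar1,\dots,\bar n\}$ such that each $k\in[n]$ occurs exactly once, barred or unbarred. $\pi$ is an involution if for each $k\in[n]$ either $\pi_k=k$ (fixed point), $\pi_k=\bar k$ (barred fixed point), or there is $l\ne k$ with $\pi_k=l,\pi_l=k$ (two-cycle $\{k,l\}$) or with $\pi_k=\bar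 l,\pi_l=\bar k$ (barred two-cycle $\{k,l\}$). Domino insertion via growth diagrams: for $\pi\in B_n$ let $M(i,j)=1$ if $\pi_i=j$, $M(i,j)=-1$ if $\pi_i=\bar j$, $M(i,j)=0$ otherwise ($i,j\in[n]$). The growth diagram is the array of partitions $\lambda_{(i,j)}$, $1\le i,j\le n+1$, with $\lambda_{(1,j)}=\lambda_{(i,1)}=\delta_r$, and, for $i,j\in[n]$, writing $\lambda=\lambda_{(i,j)},\mu=\lambda_{(i+1,j)},\nu=\lambda_{(i,j+1)}$, $\rho=\lambda_{(i+1,j+1)}$ is determined by: (1) if $M(i,j)=1$ (then $\lambda=\mu=\nu$), $\rho$ is $\lambda$ with two cells appended to its first row; (2) if $M(i,j)=-1$ (then $\lambda=\mu=\nu$), $\rho$ is $\lambda$ with two cells appended to its first column; (3) if $M(i,j)=0$ and $\lambda=\mu$ or $\lambda=\nu$, $\rho$ is the largest of $\lambda,\mu,\nu$; (4) otherwise $M(i,j)=0$ and $\gamma=\nu/\lambda$, $\gamma'=\mu/\lambda$ are dominoes: if $\gamma\cap\gamma'=\emptyset$ then $\rho=\lambda\cup\gamma\cup\gamma'$; if $\gamma\cap\gamma'$ is a single cell $(k,l)$ then $\rho=\lambda\cup\gamma\cup\gamma'\cup\{(k+1,l+1)\}$; if $\gamma=\gamma'$ is vertical in column $l$, $\rho$ is $\lambda\cup\gamma$ with two cells appended to the bottom of column $l+1$; if $\gamma=\gamma'$ is horizontal in row $k$, $\rho$ is $\lambda\cup\gamma$ with two cells appended to the end of row $k+1$. These rules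 are well defined, and consecutive partitions in the last row and last column differ by exactly one domino. The insertion tableau $P_d^r(\pi)$ is the SDT given by the chain $\lambda_{(n+1,1)}\subset\lambda_{(n+1,2)}\subset\cdots\subset\lambda_{(n+1,n+1)}$ and the recording tableau $Q_d^r(\pi)$ is the SDT given by $\lambda_{(1,n+1)}\subset\lambda_{(2,n+1)}\subset\cdots\subset\lambda_{(n+1,n+1)}$. Sign of an SDT $D$ with 2-core $\delta_0$ or $\delta_1$: let $T(D)$ be the standard Young tableau obtained (for $r=0$) by filling the two cells of the domino with value $k$ with $2k-1,2k$, or (for $r=1$) by putting $1$ in the core cell and filling the domino with value $k$ with $2k,2k+1$, in each case the smaller number in the left (horizontal domino) or upper (vertical domino) cell. The reading word of a standard Young tableau reads the rows from top to bottom, each from left to right; $\mathrm{sign}(D)$ is the sign of the reading word of $T(D)$ as a permutation. -}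

module Defs where

open import Data.Fin.Base as Fin using (Fin; toℕ; fromℕ; fromℕ<; inject₁)
import Data.Fin.Properties as Fin
open import Data.Integer.Base as ℤ using (ℤ; -1ℤ)
open import Data.List.Base
  using (List; []; _∷_; length; map; concat; zipWith; upTo; filter;
         applyDownFrom; allFin; cartesianProduct)
import Data.List.Membership.DecPropositional as DecMembership
open import Data.List.Properties using (≡-dec)
open import Data.List.Relation.Binary.Subset.Propositional using (_⊆_)
open import Data.List.Relation.Unary.All using (All)
open import Data.List.Relation.Unary.Any using (index)
open import Data.List.Relation.Unary.Linked using (Linked)
open import Data.Nat.Base using (ℕ; zero; suc; _+_; _*_; _≤_; _<_; _≥_; _⊔_)
open import Data.Nat.Properties using (_≟_; _<?_; ≤-refl; <⇒≤)
open import Data.Product.Base using (_×_; _,_; ∃-syntax)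
open import Data.Product.Properties using () renaming (≡-dec to ×-≡-dec)
open import Data.Product using (∃!)
open import Data.Sum.Base using (_⊎_)
open import Data.Vec.Base using (Vec; lookup)
open import Relation.Binary.Definitions using (DecidableEquality)
open import Relation.Binary.PropositionalEquality.Core using (_≡_; _≢_; refl; cong)
open import Relation.Nullary.Decidable using (Dec; yes; no; map′; ¬?; _×-dec_)

------------------------------------------------------------------------
-- Young diagrams

-- A shape lists the row lengths from top to bottom.
Shape : Set
Shape = List ℕ

IsPartition : Shape → Set
IsPartition s = Linked _≥_ s × All (0 <_) s

-- Cells are pairs (row , column), both numbered from 0.
Cell : Set
Cell = ℕ × ℕ

_≟ᶜ_ : DecidableEquality Cell
_≟ᶜ_ = ×-≡-dec _≟_ _≟_

_≟ˢ_ : DecidableEquality Shape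
_≟ˢ_ = ≡-dec _≟_

open DecMembership _≟ᶜ_ using (_∈?_)

-- Row by row from the top, each row from left to right.
cells : Shape → List Cell
cells s = concat (zipWith (λ k m → map (k ,_) (upTo m)) (upTo (length s)) s)

-- The cells of the skew shape ν / μ, in the same order as in `cells`.
_╱_ : Shape → Shape → List Cell
ν ╱ μ = filter (λ c → ¬? (c ∈? cells μ)) (cells ν)

_∩_ : List Cell → List Cell → List Cell
γ ∩ γ′ = filter (_∈? γ′) γ

_∪_ : Shape → Shape → Shape
[]      ∪ ν       = ν
(a ∷ μ) ∪ []      = a ∷ μ
(a ∷ μ) ∪ (b ∷ ν) = (a ⊔ b) ∷ (μ ∪ ν)

-- Append one cell to the end of row k.  If there are fewer than k rows, the
-- result is not a partition.
addCell : ℕ → Shape → Shape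
addCell zero    []      = 1 ∷ []
addCell zero    (m ∷ s) = suc m ∷ s
addCell (suc k) []      = 0 ∷ addCell k []
addCell (suc k) (m ∷ s) = m ∷ addCell k s

appendToRow : ℕ → Shape → Shape
appendToRow k s = addCell k (addCell k s)

columnLength : ℕ → Shape → ℕ
columnLength l s = length (filter (l <?_) s)

-- With h the length of column l, the two cells (h , l) and (h + 1 , l) are
-- the ends of their rows whenever the result is a partition.
appendToColumn : ℕ → Shape → Shape
appendToColumn l s = addCell (suc h) (addCell h s)
  where h = columnLength l s

δ : ℕ → Shape
δ r = applyDownFrom suc r

------------------------------------------------------------------------
-- Standard domino tableaux

-- The two cells are listed in the order of `cells`: the left or the upper
-- cell comes first.
data IsDomino : List Cell → Set where
  horizontal : ∀ k l → IsDomino ((k , l) ∷ (k , suc l) ∷ [])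
  vertical   : ∀ k l → IsDomino ((k , l) ∷ (suc k , l) ∷ [])

-- The final shape has 2-core δ r and size |δ r| + 2n because it is reached
-- from δ r by adding n dominoes.
record SDT (r n : ℕ) : Set where
  field
    chain       : Fin (suc n) → Shape
    isPartition : ∀ k → IsPartition (chain k)
    start       : chain Fin.zero ≡ δ r
    increasing  : ∀ (k : Fin n) → cells (chain (inject₁ k)) ⊆ cells (chain (Fin.suc k))
    isDomino    : ∀ (k : Fin n) → IsDomino (chain (Fin.suc k) ╱ chain (inject₁ k))

  shape : Shape
  shape = chain (fromℕ n)

  -- The domino with value k + 1.
  domino : Fin n → List Cell
  domino k = chain (Fin.suc k) ╱ chain (inject₁ k)

open SDT public

inversions : List ℕ → ℕ
inversions []      = 0
inversions (x ∷ w) = length (filter (_<? x) w) + inversions w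

wordSign : List ℕ → ℤ
wordSign w = -1ℤ ℤ.^ inversions w

-- The entry of T(D) in a cell of D.  For r ≤ 1 the core has r cells, so the
-- domino with value k + 1 receives r + 2k + 1 and r + 2k + 2 in the order of
-- `domino`; a cell in no domino is the core cell, with entry 1.
entry : ∀ (r : Fin 2) {n} → SDT (toℕ r) n → Cell → ℕ
entry r D c with Fin.any? (λ k → c ∈? domino D k)
... | yes (k , c∈) = suc (toℕ r + 2 * toℕ k + toℕ (index c∈))
... | no  _        = 1

readingWord : ∀ (r : Fin 2) {n} → SDT (toℕ r) n → List ℕ
readingWord r D = map (entry r D) (cells (shape D))

sign : ∀ (r : Fin 2) {n} → SDT (toℕ r) n → ℤ
sign r D = wordSign (readingWord r D)

------------------------------------------------------------------------
-- Signed permutations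

data Letter (n : ℕ) : Set where
  plain : Fin n → Letter n
  bar   : Fin n → Letter n

∣_∣ : ∀ {n} → Letter n → Fin n
∣ plain k ∣ = k
∣ bar k ∣   = k

_≟ˡ_ : ∀ {n} → DecidableEquality (Letter n)
plain k ≟ˡ plain l = map′ (cong plain) (λ { refl → refl }) (k Fin.≟ l)
plain _ ≟ˡ bar _   = no λ ()
bar _   ≟ˡ plain _ = no λ ()
bar k   ≟ˡ bar l   = map′ (cong bar) (λ { refl → refl }) (k Fin.≟ l)

record B (n : ℕ) : Set where
  field
    word       : Vec (Letter n) n
    occursOnce : ∀ k → ∃! _≡_ (λ i → ∣ lookup word i ∣ ≡ k)

  letter : Fin n → Letter n
  letter = lookup word

open B public

IsTwoCycle : ∀ {n} → B n → Fin n → Fin n → Set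
IsTwoCycle π k l = k ≢ l × letter π k ≡ plain l × letter π l ≡ plain k

IsBarredTwoCycle : ∀ {n} → B n → Fin n → Fin n → Set
IsBarredTwoCycle π k l = k ≢ l × letter π k ≡ bar l × letter π l ≡ bar k

IsInvolution : ∀ {n} → B n → Set
IsInvolution π = ∀ k →
  letter π k ≡ plain k ⊎ letter π k ≡ bar k ⊎
  (∃[ l ] IsTwoCycle π k l) ⊎ (∃[ l ] IsBarredTwoCycle π k l)

isBarredTwoCycle? : ∀ {n} (π : B n) k l → Dec (IsBarredTwoCycle π k l)
isBarredTwoCycle? π k l =
  ¬? (k Fin.≟ l) ×-dec (letter π k ≟ˡ bar l) ×-dec (letter π l ≟ˡ bar k)

-- Each barred two-cycle {k , l} is counted once, as the pair with k < l.
barredTwoCycles : ∀ {n} → B n → ℕ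
barredTwoCycles {n} π =
  length (filter (λ (k , l) → (k Fin.<? l) ×-dec isBarredTwoCycle? π k l)
                 (cartesianProduct (allFin n) (allFin n)))

------------------------------------------------------------------------
-- Domino insertion

data Entry : Set where
  +1′ -1′ 0′ : Entry

M : ∀ {n} → B n → Fin n → Fin n → Entry
M π i j with letter π i ≟ˡ plain j | letter π i ≟ˡ bar j
... | yes _ | _     = +1′
... | no _  | yes _ = -1′
... | no _  | no _  = 0′

-- The shape ρ when γ = ν / λ and γ′ = μ / λ are both dominoes.  The last
-- argument is γ ∩ γ′.
--  * If γ ∩ γ′ = {(k , l)}, then row k + 1 of μ ∪ ν ends in column l, so the
--    appended cell is (k + 1 , l + 1).
--  * If γ = γ′, then ν = λ ∪ γ.
dominoRule : Shape → Shape → List Cell → Shape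
dominoRule μ ν []             = μ ∪ ν
dominoRule μ ν ((k , l) ∷ []) = addCell (suc k) (μ ∪ ν)
dominoRule μ ν ((k , l) ∷ (_ , l′) ∷ _) with l ≟ l′
... | yes _ = appendToColumn (suc l) ν
... | no  _ = appendToRow (suc k) ν

-- localRule m λ μ ν is ρ, with λ, μ, ν, ρ at (i , j), (i + 1 , j),
-- (i , j + 1), (i + 1 , j + 1).  When λ is equal to one of μ, ν, the largest
-- of the three is the other one.
localRule : Entry → Shape → Shape → Shape → Shape
localRule +1′ λ₀ μ ν = appendToRow 0 λ₀
localRule -1′ λ₀ μ ν = appendToColumn 0 λ₀
localRule 0′  λ₀ μ ν with λ₀ ≟ˢ μ | λ₀ ≟ˢ ν
... | yes _ | _     = ν
... | no _  | yes _ = μ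
... | no _  | no _  = dominoRule μ ν ((ν ╱ λ₀) ∩ (μ ╱ λ₀))

-- Indices run from 0 to n, so growth r π i j is the partition at
-- (i + 1 , j + 1) of the array indexed from 1.
growth : ℕ → ∀ {n} → B n → ∀ i j → .(i ≤ n) → .(j ≤ n) → Shape
growth r π zero    j       _   _   = δ r
growth r π (suc i) zero    _   _   = δ r
growth r π (suc i) (suc j) i<n j<n =
  localRule (M π (fromℕ< i<n) (fromℕ< j<n))
            (growth r π i       j       (<⇒≤ i<n) (<⇒≤ j<n))
            (growth r π (suc i) j       i<n       (<⇒≤ j<n))
            (growth r π i       (suc j) (<⇒≤ i<n) j<n)

-- D is the tableau whose chain is λ₍ₙ₊₁,₁₎ ⊂ … ⊂ λ₍ₙ₊₁,ₙ₊₁₎.  This determines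
-- the chain of D, and the sign of D depends only on its chain.
IsInsertionTableau : ∀ {r n} → B n → SDT r n → Set
IsInsertionTableau {r} {n} π D =
  ∀ (j : Fin (suc n)) → chain D j ≡ growth r π n (toℕ j) ≤-refl (Fin.toℕ≤pred[n] j)

{-# OPTIONS --safe #-}

-- Number rows and columns from 1.  Inserting the cells of a domino one at a time
-- into the reading word shows that sign(D) = (-1)^ev(D), where ev counts the
-- vertical dominoes in even columns.  With E and O the numbers of cells of a shape
-- in even and in odd columns, and v the number of vertical dominoes of a chain,
-- E - O + 2v increases by 4 for each vertical domino in an even column and is
-- otherwise constant along a chain, so that 4 ev(P) is read off from the final
-- shape and v(P).
--
-- In every square of the growth diagram the two new sides contain as many vertical
-- dominoes as the two old ones, and two more if the square carries a barred letter.
-- Because π is an involution, the diagram is symmetric, and in a square on the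
-- diagonal E - O + 2v is the same through the old side as through the new one.
-- Summing over the squares strictly below the diagonal, one finds that E - O + 2v of
-- row i up to the diagonal exceeds its value on the core by 4 times the number of
-- barred letters strictly below the diagonal in these rows.  Hence ev(P) = d.

module Submission where

open import Defs
open import Data.Bool.Base using (Bool; true; false; if_then_else_)
open import Data.Empty using (⊥; ⊥-elim)
open import Data.Fin.Base as Fin using (Fin; zero; suc; toℕ; fromℕ; fromℕ<; inject₁)
import Data.Fin.Properties as Fin
open import Data.Integer.Base as ℤ using (-1ℤ; _^_)
import Data.Integer.Properties as ℤ
open import Data.List.Base
  using (List; []; _∷_; _++_; length; map; concat; zipWith; upTo; applyUpTo; filter;
         allFin; tabulate; cartesianProduct)
import Data.List.Membership.DecPropositional as DecMembership
open import Data.List.Membership.Propositional using (_∈_; _∉_)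
open import Data.List.Membership.Propositional.Properties
  using (∈-++⁺ˡ; ∈-++⁺ʳ; ∈-++⁻; ∈-map⁻; ∈-upTo⁻; ∈-filter⁻)
open import Data.List.Properties
  using (++-assoc; length-++; length-map; length-upTo; applyUpTo-∷ʳ; map-++; map-∘; map-tabulate;
         filter-++; filter-all; filter-none; filter-accept; filter-reject)
open import Data.List.Relation.Binary.Subset.Propositional using (_⊆_)
open import Data.List.Relation.Unary.All as All using (All; []; _∷_)
import Data.List.Relation.Unary.All.Properties as All
open import Data.List.Relation.Unary.Any using (here; there; index)
open import Data.List.Relation.Unary.Linked using (Linked; []; [-]; _∷_)
open import Data.Nat.Base hiding (parity; _^_)
open import Data.Nat.ListAction using (sum)
open import Data.Nat.ListAction.Properties using (sum-++)
open import Data.Nat.Properties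
open import Data.Nat.Tactic.RingSolver using (solve-∀)
open import Data.Product.Base using (_×_; _,_; proj₁; proj₂; ∃-syntax; Σ-syntax)
open import Data.Sum.Base using (_⊎_; inj₁; inj₂; swap)
open import Data.Unit.Base using (⊤; tt)
open import Function.Base using (_∘_; id; _$_)
open import Relation.Binary.Definitions using (tri<; tri≈; tri>)
open import Relation.Binary.PropositionalEquality
open import Relation.Nullary.Decidable using (Dec; yes; no; does; ¬?; dec-true; dec-false; _×-dec_)
open import Relation.Nullary.Negation using (¬_; contradiction)

open DecMembership _≟ᶜ_ using (_∈?_)

-- Shapes as row-length functions; adding single cells and taking unions

row : Shape → ℕ → ℕ
row []      _       = 0
row (m ∷ s) zero    = m
row (m ∷ s) (suc k) = row s k

Addable : ℕ → Shape → Set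
Addable zero    s = ⊤
Addable (suc k) s = row s (suc k) < row s k

-- The Kronecker delta, defined by recursion so that it computes alongside `addCell` and `row`.
𝟙 : ℕ → ℕ → ℕ
𝟙 zero    zero    = 1
𝟙 zero    (suc j) = 0
𝟙 (suc k) zero    = 0
𝟙 (suc k) (suc j) = 𝟙 k j

𝟙-diag : ∀ k → 𝟙 k k ≡ 1
𝟙-diag zero    = refl
𝟙-diag (suc k) = 𝟙-diag k

𝟙-off : ∀ {k j} → k ≢ j → 𝟙 k j ≡ 0
𝟙-off {zero}  {zero}  k≢j = contradiction refl k≢j
𝟙-off {zero}  {suc j} k≢j = refl
𝟙-off {suc k} {zero}  k≢j = refl
𝟙-off {suc k} {suc j} k≢j = 𝟙-off (k≢j ∘ cong suc)

𝟙-suc : ∀ k → 𝟙 (suc k) k ≡ 0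
𝟙-suc k = 𝟙-off {suc k} {k} 1+n≢n

𝟙-suc′ : ∀ k → 𝟙 k (suc k) ≡ 0
𝟙-suc′ k = 𝟙-off {k} {suc k} (1+n≢n ∘ sym)

row-addCell : ∀ k s j → row (addCell k s) j ≡ 𝟙 k j + row s j
row-addCell zero    []      zero    = refl
row-addCell zero    []      (suc j) = refl
row-addCell zero    (m ∷ s) zero    = refl
row-addCell zero    (m ∷ s) (suc j) = refl
row-addCell (suc k) []      zero    = refl
row-addCell (suc k) []      (suc j) = row-addCell k [] j
row-addCell (suc k) (m ∷ s) zero    = refl
row-addCell (suc k) (m ∷ s) (suc j) = row-addCell k s j

length-addCell : ∀ k s → length (addCell k s) ≡ suc k ⊔ length s
length-addCell zero    []      = refl
length-addCell zero    (m ∷ s) = refl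
length-addCell (suc k) []      = cong suc (length-addCell k [])
length-addCell (suc k) (m ∷ s) = cong suc (length-addCell k s)

row-∪ : ∀ s t j → row (s ∪ t) j ≡ row s j ⊔ row t j
row-∪ []      t       j       = refl
row-∪ (a ∷ s) []      j       = sym (⊔-identityʳ _)
row-∪ (a ∷ s) (b ∷ t) zero    = refl
row-∪ (a ∷ s) (b ∷ t) (suc j) = row-∪ s t j

length-∪ : ∀ s t → length (s ∪ t) ≡ length s ⊔ length t
length-∪ []      t       = refl
length-∪ (a ∷ s) []      = refl
length-∪ (a ∷ s) (b ∷ t) = cong suc (length-∪ s t)

∪-comm : ∀ s t → s ∪ t ≡ t ∪ s
∪-comm []      []      = refl
∪-comm []      (b ∷ t) = refl
∪-comm (a ∷ s) []      = refl
∪-comm (a ∷ s) (b ∷ t) = cong₂ _∷_ (⊔-comm a b) (∪-comm s t)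

-- Rows past the end of the list read as 0, so `row` alone cannot see trailing zeros; hence the
-- condition on lengths.
shape-ext : ∀ {s t} → length s ≡ length t → (∀ j → row s j ≡ row t j) → s ≡ t
shape-ext {[]}    {[]}    _ _  = refl
shape-ext {a ∷ s} {b ∷ t} l eq =
  cong₂ _∷_ (eq 0) (shape-ext (suc-injective l) (eq ∘ suc))

Antitone : (ℕ → ℕ) → Set
Antitone f = ∀ k → f (suc k) ≤ f k

row-antitone : ∀ {s} → Linked _≥_ s → Antitone (row s)
row-antitone []      k       = z≤n
row-antitone [-]     zero    = z≤n
row-antitone [-]     (suc k) = z≤n
row-antitone (p ∷ l) zero    = p
row-antitone (p ∷ l) (suc k) = row-antitone l k

antitone⇒linked : ∀ s → Antitone (row s) → Linked _≥_ s
antitone⇒linked []          f = []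
antitone⇒linked (a ∷ [])    f = [-]
antitone⇒linked (a ∷ b ∷ s) f = f 0 ∷ antitone⇒linked (b ∷ s) (f ∘ suc)

antitone-≤ : ∀ {f} → Antitone f → ∀ {j k} → j ≤ k → f k ≤ f j
antitone-≤ {f} anti j≤k = go (≤⇒≤′ j≤k)
  where
  go : ∀ {j k} → j ≤′ k → f k ≤ f j
  go ≤′-refl       = ≤-refl
  go (≤′-step j≤k) = ≤-trans (anti _) (go j≤k)

-- `Addable` forces the row above the new cell to be nonempty, so the padding with rows of length 0
-- in `addCell` never happens.
addCell-positive : ∀ k s → Addable k s → All (0 <_) s → All (0 <_) (addCell k s)
addCell-positive zero          []      _ _        = s≤s z≤n ∷ []
addCell-positive zero          (m ∷ s) _ (_ ∷ ps) = s≤s z≤n ∷ ps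
addCell-positive (suc zero)    (m ∷ s) _ (p ∷ ps) = p ∷ addCell-positive 0 s tt ps
addCell-positive (suc (suc k)) (m ∷ s) a (p ∷ ps) = p ∷ addCell-positive (suc k) s a ps

addCell-antitone : ∀ k s → Addable k s → Antitone (row s) → Antitone (row (addCell k s))
addCell-antitone k s a anti j
  rewrite row-addCell k s (suc j) | row-addCell k s j with k ≟ suc j
... | yes refl rewrite 𝟙-diag j = m≤n⇒m≤o+n (𝟙 (suc j) j) a
... | no k≢ rewrite 𝟙-off k≢ = m≤n⇒m≤o+n (𝟙 k j) (anti j)

addCell-partition : ∀ k s → Addable k s → IsPartition s → IsPartition (addCell k s)
addCell-partition k s a (l , p) =
  antitone⇒linked _ (addCell-antitone k s a (row-antitone l)) , addCell-positive k s a p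

∪-positive : ∀ {s t} → All (0 <_) s → All (0 <_) t → All (0 <_) (s ∪ t)
∪-positive []       qs       = qs
∪-positive (p ∷ ps) []       = p ∷ ps
∪-positive (p ∷ ps) (q ∷ qs) = ≤-trans p (m≤m⊔n _ _) ∷ ∪-positive ps qs

∪-partition : ∀ {s t} → IsPartition s → IsPartition t → IsPartition (s ∪ t)
∪-partition {s} {t} (l , p) (l′ , p′) = antitone⇒linked _ anti , ∪-positive p p′
  where
  anti : Antitone (row (s ∪ t))
  anti k rewrite row-∪ s t (suc k) | row-∪ s t k =
    ⊔-mono-≤ (row-antitone l k) (row-antitone l′ k)

-- The reading order of the cells

rowCells : ℕ → ℕ → List Cell
rowCells i m = map (i ,_) (upTo m)

-- The diagram with its top row numbered `i`. Unlike `cells` it is recursive in the shape, which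
-- allows induction on rows.
cellsFrom : ℕ → Shape → List Cell
cellsFrom i []      = []
cellsFrom i (m ∷ s) = rowCells i m ++ cellsFrom (suc i) s

rowCells-suc : ∀ i m → rowCells i (suc m) ≡ rowCells i m ++ (i , m) ∷ []
rowCells-suc i m =
  trans (cong (map (i ,_)) (sym (applyUpTo-∷ʳ id m))) (map-++ (i ,_) (upTo m) (m ∷ []))

cells≡cellsFrom : ∀ s → cells s ≡ cellsFrom 0 s
cells≡cellsFrom = go 0 id (λ j → sym (+-identityʳ j))
  where
  -- `upTo` is `applyUpTo id`, and its tail applies `suc` instead of `id`; hence the generalisation
  -- to a shifted numbering `f`.
  go : ∀ i (f : ℕ → ℕ) → (∀ j → f j ≡ j + i) → ∀ s →
       concat (zipWith (λ k m → map (k ,_) (upTo m)) (applyUpTo f (length s)) s) ≡ cellsFrom i s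
  go i f eq []      = refl
  go i f eq (m ∷ s) = cong₂ _++_ (cong (λ k → rowCells k m) (eq 0))
    (go (suc i) (f ∘ suc) (λ j → trans (eq (suc j)) (sym (+-suc j i))) s)

∈-cellsFrom⁻ : ∀ i s {k l} → (k , l) ∈ cellsFrom i s → ∃[ j ] (k ≡ i + j × l < row s j)
∈-cellsFrom⁻ i (m ∷ s) c∈ with ∈-++⁻ (rowCells i m) c∈
... | inj₁ c∈ˡ with ∈-map⁻ (i ,_) c∈ˡ
...   | l , l∈ , refl = 0 , sym (+-identityʳ i) , ∈-upTo⁻ l∈
∈-cellsFrom⁻ i (m ∷ s) c∈ | inj₂ c∈ʳ with ∈-cellsFrom⁻ (suc i) s c∈ʳ
... | j , k≡ , l< = suc j , trans k≡ (sym (+-suc i j)) , l<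

∈-cells⁻ : ∀ s {k l} → (k , l) ∈ cells s → l < row s k
∈-cells⁻ s c∈ with ∈-cellsFrom⁻ 0 s (subst (_ ∈_) (cells≡cellsFrom s) c∈)
... | _ , refl , l< = l<


-- Dominoes added at the ends of rows

data Domino : Set where
  hor ver : ℕ → Domino

-- Direction and top row `k` determine the domino; its column is read off from the shape.
add : Domino → Shape → Shape
add (hor k) s = addCell k (addCell k s)
add (ver k) s = addCell (suc k) (addCell k s)

-- Only ensures that the two added cells share an edge. That the result is a partition is carried
-- separately.
Fits : Domino → Shape → Set
Fits (hor k) s = ⊤
Fits (ver k) s = row s k ≡ row s (suc k)

amount : Domino → ℕ → ℕ
amount (hor k) j = 𝟙 k j + 𝟙 k j
amount (ver k) j = 𝟙 (suc k) j + 𝟙 k j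

row-add : ∀ d s j → row (add d s) j ≡ amount d j + row s j
row-add (hor k) s j
  rewrite row-addCell k (addCell k s) j | row-addCell k s j = sym (+-assoc (𝟙 k j) _ _)
row-add (ver k) s j
  rewrite row-addCell (suc k) (addCell k s) j | row-addCell k s j = sym (+-assoc (𝟙 (suc k) j) _ _)

reach : Domino → ℕ
reach (hor k) = suc k
reach (ver k) = suc (suc k)

length-add : ∀ d s → length (add d s) ≡ reach d ⊔ length s
length-add (hor k) s
  rewrite length-addCell k (addCell k s) | length-addCell k s =
  trans (sym (⊔-assoc (suc k) (suc k) (length s))) (cong (_⊔ length s) (⊔-idem (suc k)))
length-add (ver k) s
  rewrite length-addCell (suc k) (addCell k s) | length-addCell k s =
  trans (sym (⊔-assoc (2 + k) (suc k) (length s))) (cong (_⊔ length s) (m≥n⇒m⊔n≡m (n≤1+n (suc k))))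

firstCell : Domino → Shape → Cell
firstCell (hor k) s = k , row s k
firstCell (ver k) s = k , row s k

secondCell : Domino → Shape → Cell
secondCell (hor k) s = k , suc (row s k)
secondCell (ver k) s = suc k , row s k

-- The number of cells between the two cells of the domino in reading order.
gap : Domino → Shape → ℕ
gap (hor k) s = 0
gap (ver k) s = row s k

record Inserted (p q : Cell) (g : ℕ) (xs ys : List Cell) : Set where
  constructor inserted
  field
    {pre mid post} : List Cell
    before : xs ≡ pre ++ mid ++ post
    after  : ys ≡ pre ++ p ∷ mid ++ q ∷ post
    gap≡   : length mid ≡ g

open Inserted

++-inserted : ∀ {p q g xs ys} zs → Inserted p q g xs ys → Inserted p q g (zs ++ xs) (zs ++ ys)
++-inserted zs (inserted {pre = A} b a g) = inserted {pre = zs ++ A}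
  (trans (cong (zs ++_) b) (sym (++-assoc zs A _)))
  (trans (cong (zs ++_) a) (sym (++-assoc zs A _))) g

length-rowCells : ∀ i m → length (rowCells i m) ≡ m
length-rowCells i m = trans (length-map _ (upTo m)) (length-upTo m)

cellsFrom-addCell₀ : ∀ i s → ∃[ B ]
  (cellsFrom i s ≡ rowCells i (row s 0) ++ B ×
   cellsFrom i (addCell 0 s) ≡ rowCells i (row s 0) ++ (i , row s 0) ∷ B)
cellsFrom-addCell₀ i []      = [] , refl , refl
cellsFrom-addCell₀ i (m ∷ s) = cellsFrom (suc i) s , refl ,
  trans (cong (_++ _) (rowCells-suc i m)) (++-assoc (rowCells i m) _ _)

-- The two cells of a horizontal domino are consecutive. Between those of a vertical one stands
-- exactly the old row `k + 1`, which by `Fits` has as many cells as row `k`.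
cellsFrom-add₀ : ∀ i d s → Fits d s →
  Inserted (proj₁ (firstCell d s) + i , proj₂ (firstCell d s))
           (proj₁ (secondCell d s) + i , proj₂ (secondCell d s))
           (gap d s) (cellsFrom i s) (cellsFrom i (add d s))
cellsFrom-add₀ i (hor zero) [] _ = inserted {pre = []} {mid = []} refl refl refl
cellsFrom-add₀ i (hor zero) (m ∷ s) _ = inserted {pre = rowCells i m} {mid = []} refl
  (trans (cong (_++ cellsFrom (suc i) s) (trans (rowCells-suc i (suc m))
                                               (cong (_++ (i , suc m) ∷ []) (rowCells-suc i m))))
    (trans (++-assoc (rowCells i m ++ (i , m) ∷ []) _ _) (++-assoc (rowCells i m) _ _))) refl
cellsFrom-add₀ i (ver zero) [] _ = inserted {pre = []} {mid = []} refl refl refl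
cellsFrom-add₀ i (ver zero) (m ∷ s) refl with cellsFrom-addCell₀ (suc i) s
... | B , eq , eq′ = inserted {pre = rowCells i m} {mid = rowCells (suc i) m}
  (cong (rowCells i m ++_) eq)
  (trans (cong₂ _++_ (rowCells-suc i m) eq′) (++-assoc (rowCells i m) _ _))
  (length-rowCells (suc i) m)
cellsFrom-add₀ i (hor (suc k)) [] f with cellsFrom-add₀ (suc i) (hor k) [] tt
... | ins rewrite +-suc k i = ins
cellsFrom-add₀ i (ver (suc k)) [] f with cellsFrom-add₀ (suc i) (ver k) [] refl
... | ins rewrite +-suc k i = ins
cellsFrom-add₀ i (hor (suc k)) (m ∷ s) f with cellsFrom-add₀ (suc i) (hor k) s f
... | ins rewrite +-suc k i = ++-inserted (rowCells i m) ins
cellsFrom-add₀ i (ver (suc k)) (m ∷ s) f with cellsFrom-add₀ (suc i) (ver k) s f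
... | ins rewrite +-suc k i = ++-inserted (rowCells i m) ins

cells-add : ∀ d s → Fits d s →
  Inserted (firstCell d s) (secondCell d s) (gap d s) (cells s) (cells (add d s))
cells-add d s f with cellsFrom-add₀ 0 d s f
... | ins rewrite cells≡cellsFrom s | cells≡cellsFrom (add d s)
  | +-identityʳ (proj₁ (firstCell d s)) | +-identityʳ (proj₁ (secondCell d s)) = ins

dominoCells : Domino → Shape → List Cell
dominoCells d s = firstCell d s ∷ secondCell d s ∷ []

dominoCells-∉ : ∀ d {s} → Fits d s → All (_∉ cells s) (dominoCells d s)
dominoCells-∉ (hor k) {s} f =
  (n≮n _ ∘ ∈-cells⁻ s) ∷ (m+n≮n 1 _ ∘ ∈-cells⁻ s) ∷ []
dominoCells-∉ (ver k) {s} f =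
  (n≮n _ ∘ ∈-cells⁻ s) ∷ (n≮n _ ∘ subst (row s k <_) (sym f) ∘ ∈-cells⁻ s) ∷ []

∈-inserted : ∀ {p q g xs ys} → Inserted p q g xs ys → ∀ {x} → x ∈ xs → x ∈ ys
∈-inserted (inserted {pre = A} {R} refl refl _) x∈ with ∈-++⁻ A x∈
... | inj₁ x∈A = ∈-++⁺ˡ x∈A
... | inj₂ x∈RB with ∈-++⁻ R x∈RB
...   | inj₁ x∈R = ∈-++⁺ʳ A (there (∈-++⁺ˡ x∈R))
...   | inj₂ x∈B = ∈-++⁺ʳ A (there (∈-++⁺ʳ R (there x∈B)))

╱-self : ∀ s → s ╱ s ≡ []
╱-self s = filter-none (λ c → ¬? (c ∈? cells s)) (All.tabulate λ c∈ c∉ → c∉ c∈)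

-- Read off from the insertion: the filter empties the three segments of old cells and keeps the two
-- new cells, which lie beyond the ends of their rows.
╱-add : ∀ d s → Fits d s → add d s ╱ s ≡ dominoCells d s
╱-add d s f with cells-add d s f | dominoCells-∉ d f
... | inserted {pre = A} {R} {B} b a _ | p∉ ∷ q∉ ∷ [] = trans (cong (filter P?) a) $
  trans (filter-++ P? A _) $ cong₂ _++_ (old A λ x∈ → in-old (∈-++⁺ˡ x∈)) $
  trans (filter-accept P? p∉) $ cong (_ ∷_) $
  trans (filter-++ P? R _) $ cong₂ _++_ (old R λ x∈ → in-old (∈-++⁺ʳ A (∈-++⁺ˡ x∈))) $
  trans (filter-accept P? q∉) $ cong (_ ∷_) $ old B λ x∈ → in-old (∈-++⁺ʳ A (∈-++⁺ʳ R x∈))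
  where
  P? = λ c → ¬? (c ∈? cells s)
  in-old : ∀ {x} → x ∈ A ++ R ++ B → x ∈ cells s
  in-old = subst (_ ∈_) (sym b)
  old : ∀ xs → (∀ {x} → x ∈ xs → x ∈ cells s) → filter P? xs ≡ []
  old xs sub = filter-none P? (All.tabulate λ x∈ x∉ → x∉ (sub x∈))

-- Counting vertical dominoes

verticality : Domino → ℕ
verticality (hor _) = 0
verticality (ver _) = 1

-- The difference of the row numbers is 1 for a vertical and 0 for a horizontal domino. The default
-- 0 covers the empty skew shape on sides where nothing changes.
verticals : List Cell → ℕ
verticals ((k , _) ∷ (k′ , _) ∷ []) = k′ ∸ k
verticals _                         = 0

verticals-add : ∀ d s → Fits d s → verticals (add d s ╱ s) ≡ verticality d
verticals-add d s f rewrite ╱-add d s f with d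
... | hor k = n∸n≡0 k
... | ver k = m+n∸n≡m 1 k

verticals-self : ∀ s → verticals (s ╱ s) ≡ 0
verticals-self s = cong verticals (╱-self s)

-- Two dominoes added to the same shape

record Step (s t : Shape) : Set where
  constructor step
  field
    piece  : Domino
    fits   : Fits piece s
    shape≡ : t ≡ add piece s

-- Every fitting domino that touches row `j` contains the first free cell of that row, so having no
-- common cell amounts to having no common row.
Disjoint : Domino → Domino → Set
Disjoint d e = ∀ j → amount d j ≡ 0 ⊎ amount e j ≡ 0

data Overlap : Domino → Domino → Set where
  same     : ∀ d → Overlap d d
  hor-ver  : ∀ k → Overlap (hor k) (ver k)
  ver-hor  : ∀ k → Overlap (ver k) (hor k)
  disjoint : ∀ {d e} → Disjoint d e → Overlap d e

𝟙-disjoint : ∀ {k k′} → k ≢ k′ → ∀ j → 𝟙 k j ≡ 0 ⊎ 𝟙 k′ j ≡ 0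
𝟙-disjoint {k} k≢k′ j with k ≟ j
... | yes refl = inj₂ (𝟙-off (k≢k′ ∘ sym))
... | no k≢j   = inj₁ (𝟙-off k≢j)

disjoint-sum : ∀ a b {c} → a ≡ 0 ⊎ c ≡ 0 → b ≡ 0 ⊎ c ≡ 0 → a + b ≡ 0 ⊎ c ≡ 0
disjoint-sum a b (inj₁ refl) (inj₁ refl) = inj₁ refl
disjoint-sum a b (inj₂ eq)   _           = inj₂ eq
disjoint-sum a b (inj₁ _)    (inj₂ eq)   = inj₂ eq

-- Rows `k` and `k + 1` start out equally long, so lengthening only the lower one breaks the
-- partition condition.
no-overhang : ∀ d s k {m} → row s k ≡ row s (suc k) → Antitone (row (add d s)) →
            amount d (suc k) ≡ suc m → amount d k ≡ 0 → ⊥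
no-overhang d s k {m} eq anti a₁ a₀ = m+1+n≰m (row s (suc k)) (begin
  row s (suc k) + suc m   ≡⟨ +-comm _ (suc m) ⟩
  suc m + row s (suc k)   ≡⟨ cong (_+ row s (suc k)) a₁ ⟨
  amount d (suc k) + row s (suc k) ≡⟨ row-add d s (suc k) ⟨
  row (add d s) (suc k)   ≤⟨ anti k ⟩
  row (add d s) k         ≡⟨ row-add d s k ⟩
  amount d k + row s k    ≡⟨ cong₂ _+_ a₀ eq ⟩
  row s (suc k)           ∎)
  where open ≤-Reasoning

hor-ver-overlap : ∀ k k′ s → Fits (ver k′) s → Antitone (row (add (hor k) s)) →
                  k ≡ k′ ⊎ Disjoint (hor k) (ver k′)
hor-ver-overlap k k′ s f anti with k ≟ k′ | k ≟ suc k′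
... | yes k≡k′ | _        = inj₁ k≡k′
... | no _     | yes refl = ⊥-elim (no-overhang (hor (suc k′)) s k′ f anti
  (cong₂ _+_ (𝟙-diag k′) (𝟙-diag k′)) (cong₂ _+_ (𝟙-suc k′) (𝟙-suc k′)))
... | no k≢k′  | no k≢1+k′ = inj₂ λ j → disjoint-sum _ _ (d j) (d j)
  where
  d : ∀ j → 𝟙 k j ≡ 0 ⊎ 𝟙 (suc k′) j + 𝟙 k′ j ≡ 0
  d j = swap (disjoint-sum _ _ (𝟙-disjoint (k≢1+k′ ∘ sym) j) (𝟙-disjoint (k≢k′ ∘ sym) j))

ver-no-overhang : ∀ k s → Fits (ver k) s → ¬ Antitone (row (add (ver (suc k)) s))
ver-no-overhang k s f anti = no-overhang (ver (suc k)) s k f anti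
  (cong₂ _+_ (𝟙-suc k) (𝟙-diag k))
  (cong₂ _+_ (𝟙-off {2 + k} {k} (m+1+n≢n 1 {k})) (𝟙-suc k))

-- Two dominoes with a common row have the same top row. Otherwise the upper one is vertical, its
-- two rows are equally long in `s`, and the lower one would lengthen only the second of them.
compare-dominoes : ∀ d e s → Fits d s → Fits e s →
          Antitone (row (add d s)) → Antitone (row (add e s)) → Overlap d e
compare-dominoes (hor k) (hor k′) s _ _ _ _ with k ≟ k′
... | yes refl = same _
... | no k≢k′  = disjoint λ j → let d = 𝟙-disjoint k≢k′ j in
  disjoint-sum _ _ (d′ d) (d′ d)
  where
  d′ : ∀ {a b} → a ≡ 0 ⊎ b ≡ 0 → a ≡ 0 ⊎ b + b ≡ 0
  d′ (inj₁ eq)   = inj₁ eq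
  d′ (inj₂ refl) = inj₂ refl
compare-dominoes (hor k) (ver k′) s _ f anti _ with hor-ver-overlap k k′ s f anti
... | inj₁ refl = hor-ver k
... | inj₂ d    = disjoint d
compare-dominoes (ver k) (hor k′) s f _ _ anti with hor-ver-overlap k′ k s f anti
... | inj₁ refl = ver-hor k
... | inj₂ d    = disjoint (swap ∘ d)
compare-dominoes (ver k) (ver k′) s f f′ anti anti′ with k ≟ k′ | k ≟ suc k′ | suc k ≟ k′
... | yes refl | _        | _        = same _
... | no _     | yes refl | _        = contradiction anti (ver-no-overhang k′ s f′)
... | no _     | no _     | yes refl = contradiction anti′ (ver-no-overhang k s f)
... | no k≢k′  | no k≢1+k′ | no 1+k≢k′ = disjoint λ j →
  disjoint-sum _ _
    (swap (disjoint-sum _ _ (𝟙-disjoint (k≢k′ ∘ sym ∘ suc-injective) j) (𝟙-disjoint (1+k≢k′ ∘ sym) j)))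
    (swap (disjoint-sum _ _ (𝟙-disjoint (k≢1+k′ ∘ sym) j) (𝟙-disjoint (k≢k′ ∘ sym) j)))

-- Evaluating the local rule on dominoes

add-≢ : ∀ d s → Fits d s → s ≢ add d s
add-≢ d s f eq with trans (sym (╱-self s)) (trans (cong (_╱ s) eq) (╱-add d s f))
... | ()

localRule-distinct : ∀ {s t u} → s ≢ t → s ≢ u →
                     localRule 0′ s t u ≡ dominoRule t u ((u ╱ s) ∩ (t ╱ s))
localRule-distinct {s} {t} {u} s≢t s≢u with s ≟ˢ t | s ≟ˢ u
... | yes s≡t | _       = contradiction s≡t s≢t
... | no _    | yes s≡u = contradiction s≡u s≢u
... | no _    | no _    = refl

localRule-dominoes : ∀ d e {s} → Fits d s → Fits e s →
  localRule 0′ s (add e s) (add d s) ≡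
  dominoRule (add e s) (add d s) (dominoCells d s ∩ dominoCells e s)
localRule-dominoes d e {s} f g =
  trans (localRule-distinct (add-≢ e s g) (add-≢ d s f))
        (cong₂ (λ γ γ′ → dominoRule (add e s) (add d s) (γ ∩ γ′)) (╱-add d s f) (╱-add e s g))

dominoCells-amount : ∀ d s → All (λ c → amount d (proj₁ c) ≢ 0) (dominoCells d s)
dominoCells-amount (hor k) s = ≢0 ∷ ≢0 ∷ []
  where
  ≢0 : 𝟙 k k + 𝟙 k k ≢ 0
  ≢0 eq = 1+n≢0 (trans (sym (𝟙-diag k)) (m+n≡0⇒m≡0 (𝟙 k k) eq))
dominoCells-amount (ver k) s =
  (λ eq → 1+n≢0 (trans (sym (𝟙-diag k)) (m+n≡0⇒n≡0 (𝟙 (suc k) k) eq))) ∷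
  (λ eq → 1+n≢0 (trans (sym (𝟙-diag k)) (m+n≡0⇒m≡0 (𝟙 k k) eq))) ∷ []

∩-disjoint : ∀ d e s → Disjoint d e → dominoCells d s ∩ dominoCells e s ≡ []
∩-disjoint d e s dis = filter-none (_∈? dominoCells e s) (All.map no∈ (dominoCells-amount d s))
  where
  no∈ : ∀ {c} → amount d (proj₁ c) ≢ 0 → c ∉ dominoCells e s
  no∈ {c} ≢0 c∈ with dis (proj₁ c)
  ... | inj₁ eq = ≢0 eq
  ... | inj₂ eq = All.lookup (dominoCells-amount e s) c∈ eq

∩-self : ∀ γ → γ ∩ γ ≡ γ
∩-self γ = filter-all (_∈? γ) (All.tabulate id)

∩-hor-ver : ∀ k s → dominoCells (hor k) s ∩ dominoCells (ver k) s ≡ (k , row s k) ∷ []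
∩-hor-ver k s = trans (filter-accept P? {x = firstCell (hor k) s} (here refl))
  (cong (firstCell (hor k) s ∷_) (filter-reject P? {x = secondCell (hor k) s}
    λ { (here eq) → 1+n≢n (cong proj₂ eq) ; (there (here eq)) → 1+n≢n (sym (cong proj₁ eq)) }))
  where P? = _∈? dominoCells (ver k) s

∩-ver-hor : ∀ k s → dominoCells (ver k) s ∩ dominoCells (hor k) s ≡ (k , row s k) ∷ []
∩-ver-hor k s = trans (filter-accept P? {x = firstCell (ver k) s} (here refl))
  (cong (firstCell (ver k) s ∷_) (filter-reject P? {x = secondCell (ver k) s}
    λ { (here eq) → 1+n≢n (cong proj₁ eq) ; (there (here eq)) → 1+n≢n (cong proj₁ eq) }))
  where P? = _∈? dominoCells (hor k) s

dominoRule-hor : ∀ t u k l → dominoRule t u ((k , l) ∷ (k , suc l) ∷ []) ≡ appendToRow (suc k) u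
dominoRule-hor t u k l with l ≟ suc l
... | yes l≡1+l = contradiction (sym l≡1+l) 1+n≢n
... | no _      = refl

dominoRule-ver : ∀ t u k l → dominoRule t u ((k , l) ∷ (suc k , l) ∷ []) ≡ appendToColumn (suc l) u
dominoRule-ver t u k l with l ≟ l
... | yes _  = refl
... | no l≢l = contradiction refl l≢l

-- Bumping: the squares whose two old sides are dominoes

∪-add : ∀ d e s → Disjoint d e → add e s ∪ add d s ≡ add d (add e s)
∪-add d e s dis = shape-ext len rows
  where
  len : length (add e s ∪ add d s) ≡ length (add d (add e s))
  len rewrite length-∪ (add e s) (add d s) | length-add d (add e s) | length-add e s | length-add d s =
    trans (⊔-comm (reach e ⊔ length s) (reach d ⊔ length s))
    (trans (⊔-assoc (reach d) (length s) _)
      (cong (reach d ⊔_) (trans (⊔-comm (length s) _)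
        (trans (⊔-assoc (reach e) _ _) (cong (reach e ⊔_) (⊔-idem (length s)))))))
  rows : ∀ j → row (add e s ∪ add d s) j ≡ row (add d (add e s)) j
  rows j rewrite row-∪ (add e s) (add d s) j | row-add d (add e s) j | row-add e s j | row-add d s j
    with dis j
  ... | inj₁ eq rewrite eq = m≥n⇒m⊔n≡m (m≤n+m (row s j) (amount e j))
  ... | inj₂ eq rewrite eq = m≤n⇒m⊔n≡n (m≤n+m (row s j) (amount d j))

fits-add : ∀ d e s → Disjoint d e → Fits d s → Fits d (add e s)
fits-add (hor k) e s dis f = tt
fits-add (ver k) e s dis f = trans (row-add e s k)
  (trans (cong₂ _+_ (trans (untouched (here refl)) (sym (untouched (there (here refl))))) f)
         (sym (row-add e s (suc k))))
  where
  untouched : ∀ {c} → c ∈ dominoCells (ver k) s → amount e (proj₁ c) ≡ 0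
  untouched {c} c∈ with dis (proj₁ c)
  ... | inj₁ eq = contradiction eq (All.lookup (dominoCells-amount (ver k) s) c∈)
  ... | inj₂ eq = eq

-- `rule` and `rule′` have the same result, so the local rule is blind to exchanging μ and ν; the
-- symmetry of the whole diagram rests on this.
record Bump (λ₀ μ ν : Shape) : Set where
  field
    ρ         : Shape
    rule      : localRule 0′ λ₀ μ ν ≡ ρ
    rule′     : localRule 0′ λ₀ ν μ ≡ ρ
    partition : IsPartition ρ
    right     : Step μ ρ
    below     : Step ν ρ
    balance   : verticals (ρ ╱ μ) + verticals (ρ ╱ ν) ≡ verticals (ν ╱ λ₀) + verticals (μ ╱ λ₀)

-- The domino added when γ and γ′ coincide: one row further down, or at the bottom of the next
-- column, whose length is measured after γ has been added.
bump : Domino → Shape → Domino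
bump (hor k) s = hor (suc k)
bump (ver k) s = ver (columnLength (suc (row s k)) (add (ver k) s))

addVertical-partition : ∀ k s → Fits (ver k) s → Addable k s → IsPartition s →
                        IsPartition (add (ver k) s)
addVertical-partition k s f a p = addCell-partition (suc k) _ below (addCell-partition k s a p)
  where
  below : row (addCell k s) (suc k) < row (addCell k s) k
  below rewrite row-addCell k s (suc k) | row-addCell k s k | 𝟙-suc′ k | 𝟙-diag k =
    s≤s (≤-reflexive (sym f))

addHorizontal-partition : ∀ k s → Addable k (addCell k s) → Addable k s → IsPartition s →
                          IsPartition (add (hor k) s)
addHorizontal-partition k s a′ a p = addCell-partition k _ a′ (addCell-partition k s a p)

columnLength-suc : ∀ l m s → l < m → columnLength l (m ∷ s) ≡ suc (columnLength l s)
columnLength-suc l m s l<m = cong length (filter-accept (l <?_) l<m)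

columnLength-short : ∀ l m s → m ≤ l → columnLength l (m ∷ s) ≡ columnLength l s
columnLength-short l m s m≤l = cong length (filter-reject (l <?_) (≤⇒≯ m≤l))

columnLength-zero : ∀ l s → Antitone (row s) → row s 0 ≤ l → columnLength l s ≡ 0
columnLength-zero l []      anti _   = refl
columnLength-zero l (m ∷ s) anti m≤l =
  trans (columnLength-short l m s m≤l) (columnLength-zero l s (anti ∘ suc) (≤-trans (anti 0) m≤l))

-- Together with `<columnLength` this identifies `columnLength l s` as the index of the first row of
-- length at most `l`.
row-columnLength : ∀ l s → Antitone (row s) → row s (columnLength l s) ≤ l
row-columnLength l []      anti = z≤n
row-columnLength l (m ∷ s) anti with l <? m
... | yes l<m rewrite columnLength-suc l m s l<m = row-columnLength l s (anti ∘ suc)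
... | no l≮m  rewrite columnLength-zero l (m ∷ s) anti (≮⇒≥ l≮m) = ≮⇒≥ l≮m

<columnLength : ∀ l s → Antitone (row s) → ∀ k → k < columnLength l s → l < row s k
<columnLength l (m ∷ s) anti k k< with l <? m
... | no l≮m  rewrite columnLength-zero l (m ∷ s) anti (≮⇒≥ l≮m) = contradiction k< n≮0
<columnLength l (m ∷ s) anti zero    k< | yes l<m = l<m
<columnLength l (m ∷ s) anti (suc k) k< | yes l<m rewrite columnLength-suc l m s l<m =
  <columnLength l s (anti ∘ suc) k (s≤s⁻¹ k<)

verticals-step : ∀ {s t} (st : Step s t) → verticals (t ╱ s) ≡ verticality (Step.piece st)
verticals-step (step d f refl) = verticals-add d _ f

Bump-swap : ∀ {s t u} → Bump s t u → Bump s u t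
Bump-swap {s} {t} {u} b = record
  { ρ = ρ ; rule = rule′ ; rule′ = rule ; partition = partition ; right = below ; below = right
  ; balance = trans (+-comm (verticals (ρ ╱ u)) (verticals (ρ ╱ t)))
                (trans balance (+-comm (verticals (u ╱ s)) (verticals (t ╱ s)))) }
  where open Bump b

bump-disjoint : ∀ d e s → Fits d s → Fits e s → IsPartition (add d s) → IsPartition (add e s) →
                Disjoint d e → Bump s (add e s) (add d s)
bump-disjoint d e s f g p q dis = record
  { ρ         = add d (add e s)
  ; rule      = trans (localRule-dominoes d e f g)
                  (trans (cong (dominoRule (add e s) (add d s)) (∩-disjoint d e s dis)) union)
  ; rule′     = trans (localRule-dominoes e d g f)
                  (trans (cong (dominoRule (add d s) (add e s)) (∩-disjoint e d s (swap ∘ dis))) union′)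
  ; partition = subst IsPartition union (∪-partition q p)
  ; right     = right
  ; below     = below
  ; balance   = trans (cong₂ _+_ (verticals-step right) (verticals-step below))
                  (sym (cong₂ _+_ (verticals-add d s f) (verticals-add e s g)))
  }
  where
  union : add e s ∪ add d s ≡ add d (add e s)
  union = ∪-add d e s dis
  union′ : add d s ∪ add e s ≡ add d (add e s)
  union′ = trans (∪-comm (add d s) (add e s)) union
  right : Step (add e s) (add d (add e s))
  right = step d (fits-add d e s dis f) refl
  below : Step (add d s) (add d (add e s))
  below = step e (fits-add e d s (swap ∘ dis) g) (trans (sym union′) (∪-add e d s (swap ∘ dis)))

row-hor : ∀ k s → row (add (hor k) s) k ≡ 2 + row s k
row-hor k s rewrite row-add (hor k) s k | 𝟙-diag k = refl

row-below-hor : ∀ k s → row (add (hor k) s) (suc k) ≡ row s (suc k)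
row-below-hor k s rewrite row-add (hor k) s (suc k) | 𝟙-suc′ k = refl

row-ver : ∀ k s → row (add (ver k) s) k ≡ suc (row s k)
row-ver k s rewrite row-add (ver k) s k | 𝟙-diag k | 𝟙-suc k = refl

row-ver-suc : ∀ k s → row (add (ver k) s) (suc k) ≡ suc (row s (suc k))
row-ver-suc k s rewrite row-add (ver k) s (suc k) | 𝟙-diag k | 𝟙-suc′ k = refl

bump-addable : ∀ l s → Antitone (row s) → Addable (columnLength l s) s
bump-addable l s anti = go (columnLength l s) refl
  where
  go : ∀ h → h ≡ columnLength l s → Addable h s
  go zero    _  = tt
  go (suc h) eq = ≤-<-trans (subst (λ x → row s x ≤ l) (sym eq) (row-columnLength l s anti))
                            (<columnLength l s anti h (≤-reflexive eq))

-- After the addition, rows `k` and `k + 1` both have length `row s k + 1`. Row `h` is the first row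
-- of at most that length, so `h ≤ k`, and rows `h` and `h + 1` are squeezed between it and row
-- `k + 1`.
row-bump : ∀ k s → Fits (ver k) s → Antitone (row (add (ver k) s)) → ∀ {h} → bump (ver k) s ≡ ver h →
           row (add (ver k) s) h ≡ suc (row s k) × row (add (ver k) s) (suc h) ≡ suc (row s k)
row-bump k s f anti {h} refl =
  ≤-antisym upper (≤-trans lower (anti h)) , ≤-antisym (≤-trans (anti h) upper) lower
  where
  ν = add (ver k) s
  upper : row ν h ≤ suc (row s k)
  upper = row-columnLength (suc (row s k)) ν anti
  h≤k : h ≤ k
  h≤k = ≮⇒≥ λ k<h → <⇒≢ (<columnLength (suc (row s k)) ν anti k k<h) (sym (row-ver k s))
  lower : suc (row s k) ≤ row ν (suc h)
  lower = ≤-trans (≤-reflexive (trans (cong suc f) (sym (row-ver-suc k s)))) (antitone-≤ anti (s≤s h≤k))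

bump-fits : ∀ d s → Fits d s → Antitone (row (add d s)) → Fits (bump d s) (add d s)
bump-fits (hor k) s f anti = tt
bump-fits (ver k) s f anti = let upper , lower = row-bump k s f anti refl in trans upper (sym lower)

bump-partition : ∀ d s → Fits d s → Antitone (row s) → IsPartition (add d s) →
                 IsPartition (add (bump d s) (add d s))
bump-partition (hor k) s f anti p = addHorizontal-partition (suc k) _ addable′ addable p
  where
  -- Row `k` has just gained two cells, which leaves room for two more in row `k + 1`.
  addable : Addable (suc k) (add (hor k) s)
  addable rewrite row-hor k s | row-below-hor k s = s≤s (m≤n⇒m≤1+n (anti k))
  addable′ : Addable (suc k) (addCell (suc k) (add (hor k) s))
  addable′ rewrite row-addCell (suc k) (add (hor k) s) (suc k) | row-addCell (suc k) (add (hor k) s) k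
    | 𝟙-diag k | 𝟙-suc k | row-hor k s | row-below-hor k s = s≤s (s≤s (anti k))
bump-partition (ver k) s f anti p = addVertical-partition _ _
  (bump-fits (ver k) s f anti′) (bump-addable _ _ anti′) p
  where
  anti′ : Antitone (row (add (ver k) s))
  anti′ = row-antitone (proj₁ p)

localRule-same : ∀ d s → Fits d s → localRule 0′ s (add d s) (add d s) ≡ add (bump d s) (add d s)
localRule-same d s f = trans (localRule-dominoes d d f f)
  (trans (cong (dominoRule (add d s) (add d s)) (∩-self (dominoCells d s))) (evaluate d))
  where
  evaluate : ∀ d → dominoRule (add d s) (add d s) (dominoCells d s) ≡ add (bump d s) (add d s)
  evaluate (hor k) = dominoRule-hor (add (hor k) s) _ k (row s k)
  evaluate (ver k) = dominoRule-ver (add (ver k) s) _ k (row s k)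

verticality-bump : ∀ d s → verticality (bump d s) ≡ verticality d
verticality-bump (hor k) s = refl
verticality-bump (ver k) s = refl

bump-same : ∀ d s → Fits d s → IsPartition s → IsPartition (add d s) → Bump s (add d s) (add d s)
bump-same d s f q p = record
  { ρ         = add (bump d s) (add d s)
  ; rule      = localRule-same d s f
  ; rule′     = localRule-same d s f
  ; partition = bump-partition d s f (row-antitone (proj₁ q)) p
  ; right     = next
  ; below     = next
  ; balance   = cong₂ _+_ eq eq
  }
  where
  next : Step (add d s) (add (bump d s) (add d s))
  next = step (bump d s) (bump-fits d s f (row-antitone (proj₁ p))) refl
  eq : verticals (add (bump d s) (add d s) ╱ add d s) ≡ verticals (add d s ╱ s)
  eq = trans (verticals-step next) (trans (verticality-bump d s) (sym (verticals-add d s f)))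

-- The two dominoes share their first cell, and the appended cell completes a 2 by 2 square. From μ,
-- which has the left column, the right column is still missing; from ν, which has the top row, the
-- bottom row is. So each direction occurs once among the old and once among the new sides.
module Crossing (k : ℕ) (s : Shape) (f : Fits (ver k) s)
                (p : IsPartition (add (hor k) s)) (q : IsPartition (add (ver k) s)) where

  μ ν ρ : Shape
  μ = add (ver k) s
  ν = add (hor k) s
  ρ = addCell (suc k) (μ ∪ ν)

  absorb : ∀ a b L → b ≤ a → a ⊔ (b ⊔ L) ≡ a ⊔ L
  absorb a b L b≤a = trans (sym (⊔-assoc a b L)) (cong (_⊔ L) (m≥n⇒m⊔n≡m b≤a))

  length-ρ : length ρ ≡ suc (suc k) ⊔ length s
  length-ρ
    rewrite length-addCell (suc k) (μ ∪ ν) | length-∪ μ ν | length-add (ver k) s | length-add (hor k) s =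
    trans (cong (suc (suc k) ⊔_) (m≥n⇒m⊔n≡m (⊔-monoˡ-≤ (length s) (n≤1+n (suc k)))))
          (absorb (suc (suc k)) _ (length s) ≤-refl)

  ρ≡μ : ρ ≡ add (ver k) μ
  ρ≡μ = shape-ext len rows
    where
    len : length ρ ≡ length (add (ver k) μ)
    len rewrite length-add (ver k) μ | length-add (ver k) s =
      trans length-ρ (sym (absorb (suc (suc k)) _ (length s) ≤-refl))
    rows : ∀ j → row ρ j ≡ row (add (ver k) μ) j
    rows j rewrite row-addCell (suc k) (μ ∪ ν) j | row-∪ μ ν j | row-add (ver k) μ j
                 | row-add (ver k) s j | row-add (hor k) s j
      with 𝟙-disjoint {k} {suc k} (1+n≢n ∘ sym) j
    ... | inj₁ eq rewrite eq | +-identityʳ (𝟙 (suc k) j) =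
      cong (𝟙 (suc k) j +_) (m≥n⇒m⊔n≡m (m≤n+m (row s j) (𝟙 (suc k) j)))
    ... | inj₂ eq rewrite eq =
      trans (m≤n⇒m⊔n≡n (+-monoˡ-≤ (row s j) (m≤m+n (𝟙 k j) (𝟙 k j)))) (+-assoc (𝟙 k j) _ _)

  ρ≡ν : ρ ≡ add (hor (suc k)) ν
  ρ≡ν = shape-ext len rows
    where
    len : length ρ ≡ length (add (hor (suc k)) ν)
    len rewrite length-add (hor (suc k)) ν | length-add (hor k) s =
      trans length-ρ (sym (absorb (suc (suc k)) _ (length s) (n≤1+n (suc k))))
    rows : ∀ j → row ρ j ≡ row (add (hor (suc k)) ν) j
    rows j rewrite row-addCell (suc k) (μ ∪ ν) j | row-∪ μ ν j | row-add (hor (suc k)) ν j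
                 | row-add (ver k) s j | row-add (hor k) s j
      with 𝟙-disjoint {k} {suc k} (1+n≢n ∘ sym) j
    ... | inj₁ eq rewrite eq | +-identityʳ (𝟙 (suc k) j) =
      trans (cong (𝟙 (suc k) j +_) (m≥n⇒m⊔n≡m (m≤n+m (row s j) (𝟙 (suc k) j))))
            (sym (+-assoc (𝟙 (suc k) j) _ _))
    ... | inj₂ eq rewrite eq =
      m≤n⇒m⊔n≡n (+-monoˡ-≤ (row s j) (m≤m+n (𝟙 k j) (𝟙 k j)))

  addable : Addable (suc k) (μ ∪ ν)
  addable rewrite row-∪ μ ν (suc k) | row-∪ μ ν k | row-ver k s | row-ver-suc k s
                | row-hor k s | row-below-hor k s | sym f
                | m≥n⇒m⊔n≡m (n≤1+n (row s k)) = s≤s (m≤n⊔m (row s k) (suc (row s k)))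

  right : Step μ ρ
  right = step (ver k) (trans (row-ver k s) (trans (cong suc f) (sym (row-ver-suc k s)))) ρ≡μ

  below : Step ν ρ
  below = step (hor (suc k)) tt ρ≡ν

  bump-crossing : Bump s μ ν
  bump-crossing = record
    { ρ         = ρ
    ; rule      = trans (localRule-dominoes (hor k) (ver k) tt f) (cong (dominoRule μ ν) (∩-hor-ver k s))
    ; rule′     = trans (localRule-dominoes (ver k) (hor k) f tt)
                    (trans (cong (dominoRule ν μ) (∩-ver-hor k s)) (cong (addCell (suc k)) (∪-comm ν μ)))
    ; partition = addCell-partition (suc k) _ addable (∪-partition q p)
    ; right     = right
    ; below     = below
    ; balance   = trans (cong₂ _+_ (verticals-step right) (verticals-step below))
                    (sym (cong₂ _+_ (verticals-add (hor k) s tt) (verticals-add (ver k) s f)))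
    }

bumping : ∀ {s t u} → IsPartition s → IsPartition t → IsPartition u → Step s t → Step s u → Bump s t u
bumping {s} ps pt pu (step e g refl) (step d f refl)
  with compare-dominoes d e s f g (row-antitone (proj₁ pu)) (row-antitone (proj₁ pt))
... | same d       = bump-same d s f ps pu
... | hor-ver k    = Crossing.bump-crossing k s g pu pt
... | ver-hor k    = Bump-swap (Crossing.bump-crossing k s f pt pu)
... | disjoint dis = bump-disjoint d e s f g pu pt dis

-- Cells in even and in odd columns

oddness : ℕ → ℕ
oddness zero          = 0
oddness (suc zero)    = 1
oddness (suc (suc n)) = oddness n

oddness-suc : ∀ n → oddness (suc n) + oddness n ≡ 1
oddness-suc zero          = refl
oddness-suc (suc zero)    = refl
oddness-suc (suc (suc n)) = oddness-suc n

half-suc : ∀ n → ⌊ suc n /2⌋ ≡ oddness n + ⌊ n /2⌋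
half-suc zero          = refl
half-suc (suc zero)    = refl
half-suc (suc (suc n)) = trans (cong suc (half-suc n)) (sym (+-suc (oddness n) _))

-- As in the paper, columns are numbered from 1: the even ones have odd index.
evenColumns oddColumns : Shape → ℕ
evenColumns []      = 0
evenColumns (m ∷ s) = ⌊ m /2⌋ + evenColumns s
oddColumns []       = 0
oddColumns (m ∷ s)  = ⌈ m /2⌉ + oddColumns s

-- The new cell has column index `row s k` counted from 0, so it lies in an even column exactly if
-- this number is odd.
evenColumns-addCell : ∀ k s → evenColumns (addCell k s) ≡ oddness (row s k) + evenColumns s
evenColumns-addCell zero    []      = refl
evenColumns-addCell zero    (m ∷ s) rewrite half-suc m = +-assoc (oddness m) _ _
evenColumns-addCell (suc k) []      = evenColumns-addCell k []
evenColumns-addCell (suc k) (m ∷ s) rewrite evenColumns-addCell k s =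
  exchange ⌊ m /2⌋ (oddness (row s k)) (evenColumns s)
  where
  exchange : ∀ a b c → a + (b + c) ≡ b + (a + c)
  exchange = solve-∀

oddColumns-addCell : ∀ k s → oddColumns (addCell k s) ≡ oddness (suc (row s k)) + oddColumns s
oddColumns-addCell zero    []      = refl
oddColumns-addCell zero    (m ∷ s) =
  trans (cong (_+ oddColumns s) (half-suc (suc m))) (+-assoc (oddness (suc m)) ⌈ m /2⌉ (oddColumns s))
oddColumns-addCell (suc k) []      = oddColumns-addCell k []
oddColumns-addCell (suc k) (m ∷ s) rewrite oddColumns-addCell k s =
  exchange ⌈ m /2⌉ (oddness (suc (row s k))) (oddColumns s)
  where
  exchange : ∀ a b c → a + (b + c) ≡ b + (a + c)
  exchange = solve-∀

row-addCell-same : ∀ k s → row (addCell k s) k ≡ suc (row s k)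
row-addCell-same k s = trans (row-addCell k s k) (cong (_+ row s k) (𝟙-diag k))

row-addCell-suc : ∀ k s → row (addCell k s) (suc k) ≡ row s (suc k)
row-addCell-suc k s = trans (row-addCell k s (suc k)) (cong (_+ row s (suc k)) (𝟙-suc′ k))

evenColumns-hor : ∀ k s → evenColumns (add (hor k) s) ≡ 1 + evenColumns s
evenColumns-hor k s
  rewrite evenColumns-addCell k (addCell k s) | evenColumns-addCell k s | row-addCell-same k s =
  trans (sym (+-assoc (oddness (suc (row s k))) _ _)) (cong (_+ evenColumns s) (oddness-suc (row s k)))

oddColumns-hor : ∀ k s → oddColumns (add (hor k) s) ≡ 1 + oddColumns s
oddColumns-hor k s
  rewrite oddColumns-addCell k (addCell k s) | oddColumns-addCell k s | row-addCell-same k s =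
  trans (sym (+-assoc (oddness (row s k)) _ _))
        (cong (_+ oddColumns s) (trans (+-comm (oddness (row s k)) _) (oddness-suc (row s k))))

evenColumns-ver : ∀ k s → Fits (ver k) s →
                  evenColumns (add (ver k) s) ≡ oddness (row s k) + oddness (row s k) + evenColumns s
evenColumns-ver k s f
  rewrite evenColumns-addCell (suc k) (addCell k s) | evenColumns-addCell k s | row-addCell-suc k s | f =
  sym (+-assoc (oddness (row s (suc k))) _ _)

oddColumns-ver : ∀ k s → Fits (ver k) s →
                 oddColumns (add (ver k) s) ≡
                 oddness (suc (row s k)) + oddness (suc (row s k)) + oddColumns s
oddColumns-ver k s f
  rewrite oddColumns-addCell (suc k) (addCell k s) | oddColumns-addCell k s | row-addCell-suc k s | f =
  sym (+-assoc (oddness (suc (row s (suc k)))) _ _)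

-- The first factor recognises vertical dominoes, the second those in an even column when columns
-- are numbered from 1.
evenVerticals : List Cell → ℕ
evenVerticals ((k , l) ∷ (k′ , _) ∷ []) = (k′ ∸ k) * oddness l
evenVerticals _                         = 0

-- A horizontal domino has one cell of each column parity. A vertical one in an even column raises E
-- by 2 and 2v by 2; in an odd column the 2 cells in O cancel against 2v. Negative terms stand on
-- the opposite side, as the numbers are natural.
columns-step : ∀ {s t} → Step s t →
  evenColumns t + oddColumns s + 2 * verticals (t ╱ s) ≡
  evenColumns s + oddColumns t + 4 * evenVerticals (t ╱ s)
columns-step {s} (step (hor k) f refl)
  rewrite ╱-add (hor k) s f | n∸n≡0 k | evenColumns-hor k s | oddColumns-hor k s =
  identity (evenColumns s) (oddColumns s)
  where
  identity : ∀ a b → 1 + a + b + 0 ≡ a + (1 + b) + 0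
  identity = solve-∀
columns-step {s} (step (ver k) f refl)
  rewrite ╱-add (ver k) s f | m+n∸n≡m 1 k | evenColumns-ver k s f | oddColumns-ver k s f =
  identity (oddness (row s k)) (oddness (suc (row s k))) (evenColumns s) (oddColumns s)
           (oddness-suc (row s k))
  where
  reorder : ∀ p q a b → p + p + a + b + 2 * (q + p) ≡ a + (q + q + b) + 4 * (1 * p)
  reorder = solve-∀
  identity : ∀ p q a b → q + p ≡ 1 → p + p + a + b + 2 ≡ a + (q + q + b) + 4 * (1 * p)
  identity p q a b eq = trans (cong (λ x → p + p + a + b + 2 * x) (sym eq)) (reorder p q a b)

-- The domino and its bump are both horizontal, with one cell of each parity apiece, or both
-- vertical and in adjacent columns, hence of opposite parity.
columns-bump : ∀ d s → Fits d s → Antitone (row (add d s)) →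
  evenColumns (add (bump d s) (add d s)) ≡ 2 + evenColumns s ×
  oddColumns (add (bump d s) (add d s)) ≡ 2 + oddColumns s
columns-bump (hor k) s f anti
  rewrite evenColumns-hor (suc k) (add (hor k) s) | oddColumns-hor (suc k) (add (hor k) s)
        | evenColumns-hor k s | oddColumns-hor k s = refl , refl
columns-bump (ver k) s f anti
  rewrite evenColumns-ver _ (add (ver k) s) (bump-fits (ver k) s f anti)
        | oddColumns-ver _ (add (ver k) s) (bump-fits (ver k) s f anti)
        | evenColumns-ver k s f | oddColumns-ver k s f
        | proj₁ (row-bump k s f anti refl) =
  identity (oddness (suc (row s k))) (oddness (row s k)) (evenColumns s) (oddness-suc (row s k)) ,
  identity (oddness (row s k)) (oddness (suc (row s k))) (oddColumns s)
           (trans (+-comm (oddness (row s k)) _) (oddness-suc (row s k)))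
  where
  reorder : ∀ p q a → p + p + (q + q + a) ≡ 2 * (p + q) + a
  reorder = solve-∀
  identity : ∀ p q a → p + q ≡ 1 → p + p + (q + q + a) ≡ 2 + a
  identity p q a eq = trans (reorder p q a) (cong (λ x → 2 * x + a) eq)

sumBelow : ℕ → (ℕ → ℕ) → ℕ
sumBelow zero    f = 0
sumBelow (suc n) f = sumBelow n f + f n

columns-chain : ∀ (C : ℕ → Shape) n → (∀ j → j < n → Step (C j) (C (suc j))) →
  evenColumns (C n) + oddColumns (C 0) + 2 * sumBelow n (λ j → verticals (C (suc j) ╱ C j)) ≡
  evenColumns (C 0) + oddColumns (C n) + 4 * sumBelow n (λ j → evenVerticals (C (suc j) ╱ C j))
columns-chain C zero    steps = refl
columns-chain C (suc n) steps =
  telescope (evenColumns (C n)) (evenColumns (C (suc n))) (evenColumns (C 0))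
            (oddColumns (C n)) (oddColumns (C (suc n))) (oddColumns (C 0))
            (sumBelow n v) (v n) (sumBelow n x) (x n)
            (columns-chain C n λ j j<n → steps j (m<n⇒m<1+n j<n)) (columns-step (steps n ≤-refl))
  where
  v x : ℕ → ℕ
  v j = verticals (C (suc j) ╱ C j)
  x j = evenVerticals (C (suc j) ╱ C j)
  left : ∀ e e′ o o₀ v v′ →
         e′ + o₀ + 2 * (v + v′) + (e + o) ≡ e + o₀ + 2 * v + (e′ + o + 2 * v′)
  left = solve-∀
  right : ∀ e e₀ o o′ x x′ →
          e₀ + o + 4 * x + (e + o′ + 4 * x′) ≡ e₀ + o′ + 4 * (x + x′) + (e + o)
  right = solve-∀
  telescope : ∀ e e′ e₀ o o′ o₀ v v′ x x′ →
    e + o₀ + 2 * v ≡ e₀ + o + 4 * x → e′ + o + 2 * v′ ≡ e + o′ + 4 * x′ →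
    e′ + o₀ + 2 * (v + v′) ≡ e₀ + o′ + 4 * (x + x′)
  telescope e e′ e₀ o o′ o₀ v v′ x x′ p q = +-cancelʳ-≡ (e + o) _ _
    (trans (left e e′ o o₀ v v′) (trans (cong₂ _+_ p q) (right e e₀ o o′ x x′)))

-- Single squares of the growth diagram

negative : Entry → ℕ
negative -1′ = 1
negative _   = 0

signedUnit : Bool → Entry
signedUnit b = if b then -1′ else +1′

-- One row of the matrix: `p` is the column of its nonzero entry, and `b` tells whether the letter
-- is barred.
entryAt : Bool → ℕ → ℕ → Entry
entryAt b p j with p ≟ j
... | yes _ = signedUnit b
... | no _  = 0′

entryAt-≡ : ∀ b {p j} → p ≡ j → entryAt b p j ≡ signedUnit b
entryAt-≡ b {p} {j} p≡j with p ≟ j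
... | yes _  = refl
... | no p≢j = contradiction p≡j p≢j

entryAt-≢ : ∀ b {p j} → p ≢ j → entryAt b p j ≡ 0′
entryAt-≢ b {p} {j} p≢j with p ≟ j
... | yes p≡j = contradiction p≡j p≢j
... | no _    = refl

localRule-left : ∀ {s t} u → s ≡ t → localRule 0′ s t u ≡ u
localRule-left {s} {t} u s≡t with s ≟ˢ t
... | yes _  = refl
... | no s≢t = contradiction s≡t s≢t

localRule-right : ∀ {s u} t → s ≡ u → localRule 0′ s t u ≡ t
localRule-right {s} {u} t s≡u with s ≟ˢ t | s ≟ˢ u
... | yes s≡t | _      = trans (sym s≡u) s≡t
... | no _    | yes _  = refl
... | no _    | no s≢u = contradiction s≡u s≢u

-- An edge of the growth diagram that crosses line c after t steps: the shape
-- changes once the nonzero entry on that line has been passed.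
data Edge (t c : ℕ) (s s′ : Shape) : Set where
  still : t ≤ c → s ≡ s′ → Edge t c s s′
  moved : c < t → Step s s′ → Edge t c s s′

edge-still : ∀ {t c s s′} → t ≤ c → Edge t c s s′ → s ≡ s′
edge-still t≤c (still _ eq)  = eq
edge-still t≤c (moved c<t _) = contradiction t≤c (<⇒≱ c<t)

edge-moved : ∀ {t c s s′} → c < t → Edge t c s s′ → Step s s′
edge-moved c<t (still t≤c _) = contradiction c<t (≤⇒≯ t≤c)
edge-moved c<t (moved _ st)  = st

edge-suc : ∀ {t c s s′} → c ≢ t → Edge t c s s′ → Edge (suc t) c s s′
edge-suc c≢t (still t≤c eq) = still (≤∧≢⇒< t≤c (c≢t ∘ sym)) eq
edge-suc c≢t (moved c<t st) = moved (m<n⇒m<1+n c<t) st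

-- `p` is the column of the nonzero entry in row `i`, and `q` the row of the nonzero entry in column
-- `j`. A barred letter makes both new sides the same vertical domino, whence the 2 in `balance`.
record Square (m : Entry) (i j p q : ℕ) (λ₀ μ ν : Shape) : Set where
  ρ : Shape
  ρ = localRule m λ₀ μ ν
  field
    partition : IsPartition ρ
    right     : Edge (suc i) q μ ρ
    below     : Edge (suc j) p ν ρ
    balance   : verticals (ρ ╱ μ) + verticals (ρ ╱ ν) ≡
                verticals (ν ╱ λ₀) + verticals (μ ╱ λ₀) + 2 * negative m
    symmetric : localRule m λ₀ μ ν ≡ localRule m λ₀ ν μ

addRow-partition : ∀ s → IsPartition s → IsPartition (add (hor 0) s)
addRow-partition s = addHorizontal-partition 0 s tt tt

-- For a partition the domino starts just below the last row, where all rows have length 0.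
firstColumn : Shape → Domino
firstColumn s = ver (columnLength 0 s)

firstColumn-row : ∀ s → Antitone (row s) → row s (columnLength 0 s) ≡ 0
firstColumn-row s anti = n≤0⇒n≡0 (row-columnLength 0 s anti)

firstColumn-fits : ∀ s → Antitone (row s) → Fits (firstColumn s) s
firstColumn-fits s anti = trans (firstColumn-row s anti)
  (sym (n≤0⇒n≡0 (≤-trans (anti _) (row-columnLength 0 s anti))))

firstColumn-partition : ∀ s → IsPartition s → IsPartition (add (firstColumn s) s)
firstColumn-partition s p = addVertical-partition _ s (firstColumn-fits s anti) (bump-addable 0 s anti) p
  where
  anti : Antitone (row s)
  anti = row-antitone (proj₁ p)

square-unit : ∀ b i j s → IsPartition s → Square (signedUnit b) i j j i s s s
square-unit false i j s p = record
  { partition = addRow-partition s p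
  ; right     = moved ≤-refl (step (hor 0) tt refl)
  ; below     = moved ≤-refl (step (hor 0) tt refl)
  ; balance   = trans (cong₂ _+_ ρ/s ρ/s) (sym (trans (+-identityʳ _) (cong₂ _+_ s/s s/s)))
  ; symmetric = refl
  }
  where
  s/s = verticals-self s
  ρ/s = verticals-add (hor 0) s tt
square-unit true i j s p = record
  { partition = firstColumn-partition s p
  ; right     = moved ≤-refl (step (firstColumn s) fits refl)
  ; below     = moved ≤-refl (step (firstColumn s) fits refl)
  ; balance   = trans (cong₂ _+_ ρ/s ρ/s) (sym (cong (_+ 2) (cong₂ _+_ s/s s/s)))
  ; symmetric = refl
  }
  where
  fits : Fits (firstColumn s) s
  fits = firstColumn-fits s (row-antitone (proj₁ p))
  s/s = verticals-self s
  ρ/s = verticals-add (firstColumn s) s fits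

square-zero : ∀ i j p q {s t u} → p ≢ j → q ≢ i →
  IsPartition s → IsPartition t → IsPartition u → Edge i q s u → Edge j p s t → Square 0′ i j p q s t u
square-zero i j p q {s} {t} {u} p≢j q≢i ps pt pu (still i≤q refl) below = record
  { partition = subst IsPartition (sym ρ≡t) pt
  ; right     = still (≤∧≢⇒< i≤q (q≢i ∘ sym)) (sym ρ≡t)
  ; below     = subst (Edge (suc j) p s) (sym ρ≡t) (edge-suc p≢j below)
  ; balance   = trans (cong (λ r → verticals (r ╱ t) + verticals (r ╱ s)) ρ≡t)
                  (trans (cong (_+ verticals (t ╱ s)) (trans (verticals-self t) (sym (verticals-self s))))
                         (sym (+-identityʳ _)))
  ; symmetric = trans ρ≡t (sym (localRule-left {s} t refl))
  }
  where
  ρ≡t : localRule 0′ s t s ≡ t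
  ρ≡t = localRule-right {s} t refl
square-zero i j p q {s} {t} {u} p≢j q≢i ps pt pu right@(moved _ _) (still j≤p refl) = record
  { partition = subst IsPartition (sym ρ≡u) pu
  ; right     = subst (Edge (suc i) q s) (sym ρ≡u) (edge-suc q≢i right)
  ; below     = still (≤∧≢⇒< j≤p (p≢j ∘ sym)) (sym ρ≡u)
  ; balance   = trans (cong (λ r → verticals (r ╱ s) + verticals (r ╱ u)) ρ≡u)
                  (trans (cong (verticals (u ╱ s) +_) (trans (verticals-self u) (sym (verticals-self s))))
                         (sym (+-identityʳ _)))
  ; symmetric = trans ρ≡u (sym (localRule-right {s} u refl))
  }
  where
  ρ≡u : localRule 0′ s s u ≡ u
  ρ≡u = localRule-left {s} u refl
square-zero i j p q {s} {t} {u} p≢j q≢i ps pt pu (moved q<i st) (moved p<j st′) = record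
  { partition = subst IsPartition (sym rule) partition
  ; right     = moved (m<n⇒m<1+n q<i) (subst (Step t) (sym rule) right)
  ; below     = moved (m<n⇒m<1+n p<j) (subst (Step u) (sym rule) below)
  ; balance   = trans (cong (λ r → verticals (r ╱ t) + verticals (r ╱ u)) rule)
                  (trans balance (sym (+-identityʳ _)))
  ; symmetric = trans rule (sym rule′)
  }
  where open Bump (bumping ps pt pu st′ st)

-- The hypotheses say that the nonzero entries of row `i` and column `j` meet in this square or both
-- miss it. If they meet here, neither old side has passed its entry yet, so the three old shapes
-- coincide.
square : ∀ b i j p q {s t u} → (p ≡ j → q ≡ i) → (q ≡ i → p ≡ j) →
  IsPartition s → IsPartition t → IsPartition u → Edge i q s u → Edge j p s t →
  Square (entryAt b p j) i j p q s t u
square b i j p q {s} p⇒q q⇒p ps pt pu right below with p ≟ j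
... | no p≢j = square-zero i j p q p≢j (p≢j ∘ q⇒p) ps pt pu right below
... | yes refl with p⇒q refl
...   | refl with edge-still ≤-refl right | edge-still ≤-refl below
...     | refl | refl = square-unit b i j s ps

-- On the diagonal both old sides are equal by symmetry. If they are a domino, it and its bump have
-- the same direction and together two cells of each parity. If the square carries a letter, a plain
-- one adds a cell of each parity, while for a barred one the two cells in the first column are
-- offset by 2v. So barred fixed points leave no trace.
diagonal-columns : ∀ b i p {s t} → IsPartition s → IsPartition t → Edge i p s t →
  let ρ = localRule (entryAt b p i) s t t in
  evenColumns ρ + oddColumns s + 2 * verticals (ρ ╱ t) ≡
  evenColumns s + oddColumns ρ + 2 * verticals (t ╱ s)
diagonal-columns b i p {s} ps pt edge with p ≟ i
diagonal-columns b i p {s} ps pt (moved p<i (step d f refl)) | no _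
  rewrite localRule-same d s f
        | verticals-step (step (bump d s) (bump-fits d s f (row-antitone (proj₁ pt))) refl)
        | verticality-bump d s | verticals-add d s f
        | proj₁ (columns-bump d s f (row-antitone (proj₁ pt)))
        | proj₂ (columns-bump d s f (row-antitone (proj₁ pt))) =
  identity (evenColumns s) (oddColumns s) (verticality d)
  where
  identity : ∀ a b c → 2 + a + b + 2 * c ≡ a + (2 + b) + 2 * c
  identity = solve-∀
diagonal-columns b i p {s} ps pt (still _ refl) | no _
  rewrite localRule-left {s} s refl = refl
diagonal-columns b i p ps pt (moved p<p _) | yes refl = contradiction p<p (n≮n p)
diagonal-columns false i p {s} ps pt (still _ refl) | yes refl
  rewrite verticals-add (hor 0) s tt | verticals-self s | evenColumns-hor 0 s | oddColumns-hor 0 s =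
  cong (_+ 0) (sym (+-suc (evenColumns s) (oddColumns s)))
diagonal-columns true i p {s} ps pt (still _ refl) | yes refl
  rewrite verticals-add (firstColumn s) s (firstColumn-fits s (row-antitone (proj₁ ps))) | verticals-self s
        | evenColumns-ver (columnLength 0 s) s (firstColumn-fits s (row-antitone (proj₁ ps)))
        | oddColumns-ver (columnLength 0 s) s (firstColumn-fits s (row-antitone (proj₁ ps)))
        | firstColumn-row s (row-antitone (proj₁ ps)) =
  identity (evenColumns s) (oddColumns s)
  where
  identity : ∀ a b → a + b + 2 ≡ a + (2 + b) + 0
  identity = solve-∀

-- The growth diagram of an involution

δ-linked : ∀ r → Linked _≥_ (δ r)
δ-linked zero          = []
δ-linked (suc zero)    = [-]
δ-linked (suc (suc r)) = n≤1+n (suc r) ∷ δ-linked (suc r)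

δ-positive : ∀ r → All (0 <_) (δ r)
δ-positive zero    = []
δ-positive (suc r) = s≤s z≤n ∷ δ-positive r

-- Rows and columns run over all natural numbers, so that no bounds occur in the recursion. As `σ`
-- is an involution, `σ j` is also the row of the nonzero entry in column `j`.
module Growth (r : ℕ) (σ : ℕ → ℕ) (b : ℕ → Bool)
              (σ-involutive : ∀ i → σ (σ i) ≡ i) (b-σ : ∀ i → b (σ i) ≡ b i) where

  m : ℕ → ℕ → Entry
  m i j = entryAt (b i) (σ i) j

  G : ℕ → ℕ → Shape
  G zero    j       = δ r
  G (suc i) zero    = δ r
  G (suc i) (suc j) = localRule (m i j) (G i j) (G (suc i) j) (G i (suc j))

  G-left : ∀ i → G i 0 ≡ δ r
  G-left zero    = refl
  G-left (suc i) = refl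

  σ-transpose : ∀ {i j} → σ i ≡ j → σ j ≡ i
  σ-transpose {i} eq = trans (cong σ (sym eq)) (σ-involutive i)

  m-symmetric : ∀ i j → m i j ≡ m j i
  m-symmetric i j with σ i ≟ j
  ... | yes refl = sym (trans (entryAt-≡ _ (σ-involutive i)) (cong signedUnit (b-σ i)))
  ... | no σi≢j  = sym (entryAt-≢ _ (σi≢j ∘ σ-transpose))

  -- Proved by mutual recursion: each square takes these facts from its old sides and passes them on
  -- to its new sides.
  partition  : ∀ i j → IsPartition (G i j)
  edge-right : ∀ i j → Edge i (σ j) (G i j) (G i (suc j))
  edge-below : ∀ i j → Edge j (σ i) (G i j) (G (suc i) j)
  square-at  : ∀ i j → Square (m i j) i j (σ i) (σ j) (G i j) (G (suc i) j) (G i (suc j))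

  partition zero    j       = δ-linked r , δ-positive r
  partition (suc i) zero    = δ-linked r , δ-positive r
  partition (suc i) (suc j) = Square.partition (square-at i j)

  edge-right zero    j = still z≤n refl
  edge-right (suc i) j = Square.right (square-at i j)

  edge-below i zero    = still z≤n (G-left i)
  edge-below i (suc j) = Square.below (square-at i j)

  square-at i j = square (b i) i j (σ i) (σ j) σ-transpose σ-transpose
    (partition i j) (partition (suc i) j) (partition i (suc j)) (edge-right i j) (edge-below i j)

  -- The transposed square carries the same entry and has μ and ν exchanged, which does not affect
  -- the local rule.
  G-symmetric : ∀ i j → G i j ≡ G j i
  G-symmetric zero    j       = sym (G-left j)
  G-symmetric (suc i) zero    = refl
  G-symmetric (suc i) (suc j)
    rewrite sym (m-symmetric i j) | G-symmetric j i | G-symmetric j (suc i) | G-symmetric (suc j) i =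
    Square.symmetric (square-at i j)

  verticalsRight verticalsBelow : ℕ → ℕ → ℕ
  verticalsRight i j = verticals (G i (suc j) ╱ G i j)
  verticalsBelow i j = verticals (G (suc i) j ╱ G i j)

  verticalsRow negatives : ℕ → ℕ → ℕ
  verticalsRow i j = sumBelow j (verticalsRight i)
  negatives i j    = sumBelow j (negative ∘ m i)

  -- Summing the balance of the squares (i , 0), …, (i , j - 1).
  verticalsRow-suc : ∀ i j →
    verticalsRow (suc i) j + verticalsBelow i j ≡ verticalsRow i j + 2 * negatives i j
  verticalsRow-suc i zero    rewrite G-left i = verticals-self (δ r)
  verticalsRow-suc i (suc j) = combine
    (verticalsRow (suc i) j) (verticalsRight (suc i) j) (verticalsBelow i (suc j)) (verticalsBelow i j)
    (verticalsRow i j) (verticalsRight i j) (negatives i j) (negative (m i j))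
    (verticalsRow-suc i j) (Square.balance (square-at i j))
    where
    left : ∀ a a′ v′ v → a + a′ + v′ + v ≡ a + v + (a′ + v′)
    left = solve-∀
    right : ∀ c c′ d d′ v → c + 2 * d + (c′ + v + 2 * d′) ≡ c + c′ + 2 * (d + d′) + v
    right = solve-∀
    combine : ∀ a a′ v′ v c c′ d d′ → a + v ≡ c + 2 * d → a′ + v′ ≡ c′ + v + 2 * d′ →
              a + a′ + v′ ≡ c + c′ + 2 * (d + d′)
    combine a a′ v′ v c c′ d d′ p q = +-cancelʳ-≡ v _ _
      (trans (left a a′ v′ v) (trans (cong₂ _+_ p q) (right c c′ d d′ v)))

  -- Barred letters in the squares `(k , j)` with `j < k < i`. A barred two-cycle has one of its two
  -- entries below the diagonal, a barred fixed point none.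
  lowerNegatives : ℕ → ℕ
  lowerNegatives i = sumBelow i (λ k → negatives k k)

  diagonal-step : ∀ i →
    evenColumns (G (suc i) (suc i)) + oddColumns (G i i) + 2 * verticalsRight (suc i) i ≡
    evenColumns (G i i) + oddColumns (G (suc i) (suc i)) + 2 * verticalsBelow i i
  -- Symmetry turns ν into μ, which brings the square into the form of `diagonal-columns`.
  diagonal-step i rewrite G-symmetric i (suc i) =
    diagonal-columns (b i) i (σ i) (partition i i) (partition (suc i) i) (edge-below i i)

  -- Moving from row `i` down to row `i + 1` costs the side `verticalsBelow i i` and gains 2 for
  -- each barred letter passed. The diagonal square gives this side back, so 2v gains 4 for each of
  -- these letters.
  diagonal : ∀ i →
    evenColumns (G i i) + oddColumns (δ r) + 2 * verticalsRow i i ≡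
    evenColumns (δ r) + oddColumns (G i i) + 4 * lowerNegatives i
  diagonal zero    = refl
  diagonal (suc i) = combine
    (evenColumns (G (suc i) (suc i))) (evenColumns (G i i)) (evenColumns (δ r))
    (oddColumns (G (suc i) (suc i))) (oddColumns (G i i)) (oddColumns (δ r))
    (verticalsRow i i) (verticalsRow (suc i) i) (verticalsBelow i i) (verticalsRight (suc i) i)
    (lowerNegatives i) (negatives i i) (diagonal i) (diagonal-step i) (verticalsRow-suc i i)
    where
    left : ∀ e′ e o o₀ w x y z →
      e′ + o₀ + 2 * (x + z) + (o + e + 2 * w + 2 * y) ≡ e + o₀ + 2 * w + (e′ + o + 2 * z) + 2 * (x + y)
    left = solve-∀
    right : ∀ e e₀ o′ o w y d d′ →
      e₀ + o + 4 * d + (e + o′ + 2 * y) + 2 * (w + 2 * d′) ≡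
      e₀ + o′ + 4 * (d + d′) + (o + e + 2 * w + 2 * y)
    right = solve-∀
    combine : ∀ e′ e e₀ o′ o o₀ w x y z d d′ →
      e + o₀ + 2 * w ≡ e₀ + o + 4 * d → e′ + o + 2 * z ≡ e + o′ + 2 * y → x + y ≡ w + 2 * d′ →
      e′ + o₀ + 2 * (x + z) ≡ e₀ + o′ + 4 * (d + d′)
    combine e′ e e₀ o′ o o₀ w x y z d d′ p q t = +-cancelʳ-≡ (o + e + 2 * w + 2 * y) _ _
      (trans (left e′ e o o₀ w x y z)
        (trans (cong₂ _+_ (cong₂ _+_ p q) (cong (2 *_) t)) (right e e₀ o′ o w y d d′)))

  -- By `σ<` every column has passed its entry at row `n`, so row `n` is a chain of dominoes. Both
  -- `columns-chain` and `diagonal` evaluate E - O + 2v on it, and the comparison leaves the two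
  -- multiples of 4.
  evenVerticalsRow : ∀ n → (∀ j → j < n → σ j < n) →
    sumBelow n (λ j → evenVerticals (G n (suc j) ╱ G n j)) ≡ lowerNegatives n
  evenVerticalsRow n σ< = *-cancelˡ-≡ _ _ 4 (+-cancelˡ-≡ (evenColumns (δ r) + oddColumns (G n n)) _ _
    (trans (sym chain-eq) (diagonal n)))
    where
    x : ℕ → ℕ
    x j = evenVerticals (G n (suc j) ╱ G n j)
    chain-eq : evenColumns (G n n) + oddColumns (δ r) + 2 * verticalsRow n n ≡
               evenColumns (δ r) + oddColumns (G n n) + 4 * sumBelow n x
    chain-eq = subst (λ s → evenColumns (G n n) + oddColumns s + 2 * verticalsRow n n ≡
               evenColumns s + oddColumns (G n n) + 4 * sumBelow n x)
      (G-left n) (columns-chain (G n) n λ j j<n → edge-moved (σ< j j<n) (edge-right n j))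

-- Inversions of the reading word

inversions-insert : ∀ xs y ys → All (_≤ y) xs → All (_< y) ys →
                    inversions (xs ++ y ∷ ys) ≡ length ys + inversions (xs ++ ys)
-- `y` forms an inversion with each entry of `ys` and with no entry before it.
inversions-insert []       y ys _            ys<y =
  cong (λ zs → length zs + inversions ys) (filter-all (_<? y) ys<y)
inversions-insert (x ∷ xs) y ys (x≤y ∷ xs≤y) ys<y = begin
  length (filter (_<? x) (xs ++ y ∷ ys)) + inversions (xs ++ y ∷ ys)
    ≡⟨ cong₂ _+_ (cong length skip) (inversions-insert xs y ys xs≤y ys<y) ⟩
  a + (length ys + inversions (xs ++ ys))
    ≡⟨ exchange a (length ys) (inversions (xs ++ ys)) ⟩
  length ys + (a + inversions (xs ++ ys)) ∎
  where
  open ≡-Reasoning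
  a = length (filter (_<? x) (xs ++ ys))
  skip : filter (_<? x) (xs ++ y ∷ ys) ≡ filter (_<? x) (xs ++ ys)
  skip = trans (filter-++ (_<? x) xs (y ∷ ys))
    (trans (cong (filter (_<? x) xs ++_) (filter-reject (_<? x) (≤⇒≯ x≤y)))
           (sym (filter-++ (_<? x) xs ys)))
  exchange : ∀ a b c → a + (b + c) ≡ b + (a + c)
  exchange = solve-∀

-- The two new cells carry the largest entries, so the cells after the second
-- one are counted twice and those between the two cells once.
inversions-inserted : ∀ {p q g xs ys} (f : Cell → ℕ) → Inserted p q g xs ys →
  f q ≡ suc (f p) → (∀ {x} → x ∈ xs → f x < f p) →
  ∃[ k ] inversions (map f ys) ≡ k + k + (g + inversions (map f xs))
inversions-inserted {p} {q} f (inserted {pre = A} {mid = R} {post = B} refl refl refl) fq small =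
  length (map f B) , (begin
  inversions (map f (A ++ p ∷ R ++ q ∷ B))
    ≡⟨ cong inversions (trans (map-++ f A _) (cong (λ zs → map f A ++ f p ∷ zs) (map-++ f R _))) ⟩
  inversions (map f A ++ f p ∷ map f R ++ f q ∷ map f B)
    ≡⟨ cong inversions (++-assoc (map f A) (f p ∷ map f R) _) ⟨
  inversions ((map f A ++ f p ∷ map f R) ++ f q ∷ map f B)
    -- The largest entry `f q` is taken out first; then `f p` is the largest of the rest.
    ≡⟨ inversions-insert (map f A ++ f p ∷ map f R) (f q) (map f B)
         (All.++⁺ (All.map <⇒≤ (All.map <q <A)) (<⇒≤ p<q ∷ All.map <⇒≤ (All.map <q <R))) (All.map <q <B) ⟩
  length (map f B) + inversions ((map f A ++ f p ∷ map f R) ++ map f B)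
    ≡⟨ cong (λ zs → length (map f B) + inversions zs) (++-assoc (map f A) (f p ∷ map f R) _) ⟩
  length (map f B) + inversions (map f A ++ f p ∷ map f R ++ map f B)
    ≡⟨ cong (length (map f B) +_)
         (inversions-insert (map f A) (f p) (map f R ++ map f B) (All.map <⇒≤ <A) (All.++⁺ <R <B)) ⟩
  length (map f B) + (length (map f R ++ map f B) + inversions (map f A ++ map f R ++ map f B))
    ≡⟨ cong₂ (λ l zs → length (map f B) + (l + inversions zs))
         (trans (length-++ (map f R)) (cong (_+ length (map f B)) (length-map f R)))
         (trans (cong (map f A ++_) (sym (map-++ f R B))) (sym (map-++ f A _))) ⟩
  length (map f B) + (length R + length (map f B) + inversions (map f (A ++ R ++ B)))
    ≡⟨ reorder (length (map f B)) (length R) _ ⟩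
  length (map f B) + length (map f B) + (length R + inversions (map f (A ++ R ++ B))) ∎)
  where
  open ≡-Reasoning
  p<q : f p < f q
  p<q = ≤-reflexive (sym fq)
  <q : ∀ {y} → y < f p → y < f q
  <q y< = <-trans y< p<q
  below : ∀ xs → (∀ {x} → x ∈ xs → x ∈ A ++ R ++ B) → All (_< f p) (map f xs)
  below xs sub = All.map⁺ (All.tabulate (small ∘ sub))
  <A : All (_< f p) (map f A)
  <A = below A ∈-++⁺ˡ
  <R : All (_< f p) (map f R)
  <R = below R (∈-++⁺ʳ A ∘ ∈-++⁺ˡ)
  <B : All (_< f p) (map f B)
  <B = below B (∈-++⁺ʳ A ∘ ∈-++⁺ʳ R)
  reorder : ∀ b r i → b + (r + b + i) ≡ b + b + (r + i)
  reorder = solve-∀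

-1^-double : ∀ k n → -1ℤ ^ (k + k + n) ≡ -1ℤ ^ n
-1^-double zero    n = refl
-1^-double (suc k) n rewrite +-suc k k =
  trans (sym (ℤ.*-assoc -1ℤ -1ℤ _)) (trans (ℤ.*-identityˡ _) (-1^-double k n))

-1^-oddness : ∀ n → -1ℤ ^ oddness n ≡ -1ℤ ^ n
-1^-oddness zero          = refl
-1^-oddness (suc zero)    = refl
-1^-oddness (suc (suc n)) = trans (-1^-oddness n) (sym (-1^-double 1 n))

-- For a vertical domino the gap equals its column index counted from 0, which is odd exactly in the
-- even columns.
-1^-gap : ∀ d s → -1ℤ ^ gap d s ≡ -1ℤ ^ evenVerticals (dominoCells d s)
-1^-gap (hor k) s rewrite n∸n≡0 k = refl
-1^-gap (ver k) s rewrite m+n∸n≡m 1 k | +-identityʳ (oddness (row s k)) = sym (-1^-oddness (row s k))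

step-⊆ : ∀ {s t} → Step s t → cells s ⊆ cells t
step-⊆ {s} (step d f refl) = ∈-inserted (cells-add d s f)

index-first : ∀ {A : Set} {x y : A} {xs} → xs ≡ x ∷ y ∷ [] → x ≢ y → (x∈ : x ∈ xs) → toℕ (index x∈) ≡ 0
index-first refl x≢y (here _)          = refl
index-first refl x≢y (there (here x≡y)) = contradiction x≡y x≢y

index-second : ∀ {A : Set} {x y : A} {xs} → xs ≡ x ∷ y ∷ [] → x ≢ y → (y∈ : y ∈ xs) → toℕ (index y∈) ≡ 1
index-second refl x≢y (here y≡x)         = contradiction (sym y≡x) x≢y
index-second refl x≢y (there (here _)) = refl

firstCell≢secondCell : ∀ d s → firstCell d s ≢ secondCell d s
firstCell≢secondCell (hor k) s eq = 1+n≢n (sym (cong proj₂ eq))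
firstCell≢secondCell (ver k) s eq = 1+n≢n (sym (cong proj₁ eq))

module Sign (r : Fin 2) {n : ℕ} (D : SDT (toℕ r) n) (C : ℕ → Shape)
            (chain≡ : ∀ k → chain D k ≡ C (toℕ k)) (steps : ∀ j → j < n → Step (C j) (C (suc j))) where

  C-⊆ : ∀ {j k} → j ≤ k → k ≤ n → cells (C j) ⊆ cells (C k)
  C-⊆ j≤k = go (≤⇒≤′ j≤k)
    where
    go : ∀ {j k} → j ≤′ k → k ≤ n → cells (C j) ⊆ cells (C k)
    go ≤′-refl       _   c∈ = c∈
    go (≤′-step j≤k) k<n c∈ = step-⊆ (steps _ k<n) (go j≤k (<⇒≤ k<n) c∈)

  domino≡ : ∀ k → SDT.domino D k ≡ C (suc (toℕ k)) ╱ C (toℕ k)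
  domino≡ k = cong₂ _╱_ (chain≡ (Fin.suc k)) (trans (chain≡ (inject₁ k)) (cong C (Fin.toℕ-inject₁ k)))

  length-domino : ∀ k → length (SDT.domino D k) ≡ 2
  length-domino k rewrite domino≡ k with steps (toℕ k) (Fin.toℕ<n k)
  ... | step d f eq rewrite eq = cong length (╱-add d (C (toℕ k)) f)

  ∈-domino : ∀ k {c} → c ∈ SDT.domino D k → c ∈ cells (C (suc (toℕ k))) × c ∉ cells (C (toℕ k))
  ∈-domino k c∈ = ∈-filter⁻ (λ c → ¬? (c ∈? cells (C (toℕ k)))) (subst (_ ∈_) (domino≡ k) c∈)

  C-start : C 0 ≡ δ (toℕ r)
  C-start = trans (sym (chain≡ Fin.zero)) (SDT.start D)

  domino-index : ∀ k {c} (c∈ : c ∈ SDT.domino D k) → toℕ (index c∈) ≤ 1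
  domino-index k c∈ = s≤s⁻¹ (subst (toℕ (index c∈) <_) (length-domino k) (Fin.toℕ<n (index c∈)))

  -- A domino containing a cell of `C j` was added before step `j`, since later dominoes avoid
  -- `C j`. A cell in no domino has entry 1.
  entry-old : ∀ {j c} → j ≤ n → c ∈ cells (C j) → entry r D c ≤ toℕ r + 2 * j
  entry-old {j} {c} j≤n c∈ with Fin.any? (λ k → c ∈? SDT.domino D k)
  entry-old {j} {c} j≤n c∈ | yes (k , c∈k) = begin
    suc (toℕ r + 2 * toℕ k + toℕ (index c∈k)) ≤⟨ s≤s (+-monoʳ-≤ (toℕ r + 2 * toℕ k) (domino-index k c∈k)) ⟩
    suc (toℕ r + 2 * toℕ k + 1)               ≡⟨ reorder (toℕ r) (toℕ k) ⟩
    toℕ r + 2 * suc (toℕ k)                   ≤⟨ +-monoʳ-≤ (toℕ r) (*-monoʳ-≤ 2 k<j) ⟩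
    toℕ r + 2 * j                             ∎
    where
    open ≤-Reasoning
    k<j : toℕ k < j
    k<j = ≰⇒> λ j≤k → proj₂ (∈-domino k c∈k) (C-⊆ j≤k (<⇒≤ (Fin.toℕ<n k)) c∈)
    reorder : ∀ a b → suc (a + 2 * b + 1) ≡ a + 2 * suc b
    reorder = solve-∀
  entry-old {suc j} j≤n c∈ | no _ = ≤-trans (s≤s z≤n) (m≤n+m (2 * suc j) (toℕ r))
  entry-old {zero}  j≤n c∈ | no _ = core r (subst (λ s → _ ∈ cells s) C-start c∈)
    where
    -- For `j = 0` the bound is `r`: it is attained by the single core cell if `r` is 1, and the
    -- core is empty if `r` is 0.
    core : ∀ (r : Fin 2) {c} → c ∈ cells (δ (toℕ r)) → 1 ≤ toℕ r + 0
    core (Fin.suc Fin.zero) _ = s≤s z≤n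

  -- Different dominoes of the chain are disjoint, so the search in `entry` ends at `k`. It may find
  -- another membership proof than the given one, hence the existential form.
  entry-new : ∀ k {c} → c ∈ SDT.domino D k →
    Σ[ c∈ ∈ (c ∈ SDT.domino D k) ] entry r D c ≡ suc (toℕ r + 2 * toℕ k + toℕ (index c∈))
  entry-new k {c} c∈ with Fin.any? (λ k → c ∈? SDT.domino D k)
  ... | no ∄ = contradiction (k , c∈) ∄
  ... | yes (k′ , c∈′) with <-cmp (toℕ k′) (toℕ k)
  ...   | tri< k′<k _ _ =
    contradiction (C-⊆ k′<k (<⇒≤ (Fin.toℕ<n k)) (proj₁ (∈-domino k′ c∈′))) (proj₂ (∈-domino k c∈))
  ...   | tri> _ _ k<k′ =
    contradiction (C-⊆ k<k′ (<⇒≤ (Fin.toℕ<n k′)) (proj₁ (∈-domino k c∈))) (proj₂ (∈-domino k′ c∈′))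
  ...   | tri≈ _ k′≡k _ with Fin.toℕ-injective k′≡k
  ...     | refl = c∈′ , refl

  -- Induction along the chain, with the entries of the full tableau throughout. The next domino
  -- carries two consecutive entries above all earlier ones, so modulo 2 only its gap is added to
  -- the inversions.
  wordSign-prefix : ∀ j → j ≤ n →
    wordSign (map (entry r D) (cells (C j))) ≡ -1ℤ ^ sumBelow j (λ k → evenVerticals (C (suc k) ╱ C k))
  wordSign-prefix zero    _   rewrite C-start = core r _
    where
    core : ∀ (r : Fin 2) (f : Cell → ℕ) → wordSign (map f (cells (δ (toℕ r)))) ≡ -1ℤ ^ 0
    core Fin.zero           f = refl
    core (Fin.suc Fin.zero) f = refl
  wordSign-prefix (suc j) j<n with steps j j<n
  ... | step d f eq = begin
    -1ℤ ^ inversions (map e (cells (C (suc j))))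
      ≡⟨ cong (λ s → -1ℤ ^ inversions (map e (cells s))) eq ⟩
    -1ℤ ^ inversions (map e (cells (add d (C j))))
      ≡⟨ cong (-1ℤ ^_) (proj₂ new-inversions) ⟩
    -1ℤ ^ (proj₁ new-inversions + proj₁ new-inversions + (gap d (C j) + inversions (map e (cells (C j)))))
      ≡⟨ -1^-double (proj₁ new-inversions) _ ⟩
    -1ℤ ^ (gap d (C j) + inversions (map e (cells (C j))))
      ≡⟨ ℤ.^-distribˡ-+-* -1ℤ (gap d (C j)) _ ⟩
    -1ℤ ^ gap d (C j) ℤ.* wordSign (map e (cells (C j)))
      ≡⟨ cong₂ ℤ._*_ (-1^-gap d (C j)) (wordSign-prefix j (<⇒≤ j<n)) ⟩
    -1ℤ ^ evenVerticals (dominoCells d (C j)) ℤ.* -1ℤ ^ sumBelow j x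
      ≡⟨ cong (λ γ → -1ℤ ^ evenVerticals γ ℤ.* -1ℤ ^ sumBelow j x) cells≡ ⟨
    -1ℤ ^ x j ℤ.* -1ℤ ^ sumBelow j x
      ≡⟨ ℤ.*-comm (-1ℤ ^ x j) _ ⟩
    -1ℤ ^ sumBelow j x ℤ.* -1ℤ ^ x j
      ≡⟨ ℤ.^-distribˡ-+-* -1ℤ (sumBelow j x) (x j) ⟨
    -1ℤ ^ sumBelow (suc j) x ∎
    where
    open ≡-Reasoning
    e : Cell → ℕ
    e = entry r D
    x : ℕ → ℕ
    x k = evenVerticals (C (suc k) ╱ C k)
    k′ : Fin n
    k′ = fromℕ< j<n
    toℕ-k′ : toℕ k′ ≡ j
    toℕ-k′ = Fin.toℕ-fromℕ< j<n
    cells≡ : C (suc j) ╱ C j ≡ dominoCells d (C j)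
    cells≡ = trans (cong (_╱ C j) eq) (╱-add d (C j) f)
    domino-k′ : SDT.domino D k′ ≡ dominoCells d (C j)
    domino-k′ = trans (domino≡ k′) (trans (cong (λ i → C (suc i) ╱ C i) toℕ-k′) cells≡)
    distinct : firstCell d (C j) ≢ secondCell d (C j)
    distinct = firstCell≢secondCell d (C j)
    entry-first : e (firstCell d (C j)) ≡ suc (toℕ r + 2 * j)
    entry-first with entry-new k′ (subst (firstCell d (C j) ∈_) (sym domino-k′) (here refl))
    ... | c∈ , eq′ = trans eq′ (trans
      (cong₂ (λ a b → suc (toℕ r + 2 * a + b)) toℕ-k′ (index-first domino-k′ distinct c∈))
      (cong suc (+-identityʳ _)))
    entry-second : e (secondCell d (C j)) ≡ suc (toℕ r + 2 * j + 1)
    entry-second with entry-new k′ (subst (secondCell d (C j) ∈_) (sym domino-k′) (there (here refl)))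
    ... | c∈ , eq′ = trans eq′
      (cong₂ (λ a b → suc (toℕ r + 2 * a + b)) toℕ-k′ (index-second domino-k′ distinct c∈))
    adjacent : e (secondCell d (C j)) ≡ suc (e (firstCell d (C j)))
    adjacent = trans entry-second (cong suc (trans (+-comm _ 1) (sym entry-first)))
    small : ∀ {c} → c ∈ cells (C j) → e c < e (firstCell d (C j))
    small c∈ = ≤-trans (s≤s (entry-old (<⇒≤ j<n) c∈)) (≤-reflexive (sym entry-first))
    new-inversions : ∃[ k ] inversions (map e (cells (add d (C j)))) ≡
                            k + k + (gap d (C j) + inversions (map e (cells (C j))))
    new-inversions = inversions-inserted e (cells-add d (C j) f) adjacent small

  sign-evenVerticals : sign r D ≡ -1ℤ ^ sumBelow n (λ k → evenVerticals (C (suc k) ╱ C k))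
  sign-evenVerticals = trans
    (cong (λ s → wordSign (map (entry r D) (cells s))) (trans (chain≡ (fromℕ n)) (cong C (Fin.toℕ-fromℕ n))))
    (wordSign-prefix n ≤-refl)

-- Signed involutions on all natural numbers

isBarred : ∀ {n} → Letter n → Bool
isBarred (plain _) = false
isBarred (bar _)   = true

extend : ∀ {A : Set} {n} → (Fin n → A) → (ℕ → A) → ℕ → A
extend {n = n} f g i with i <? n
... | yes i<n = f (fromℕ< i<n)
... | no _    = g i

extend-in : ∀ {A : Set} {n} (f : Fin n → A) g k → extend f g (toℕ k) ≡ f k
extend-in {n = n} f g k with toℕ k <? n
... | yes k<n = cong f (Fin.fromℕ<-toℕ k k<n)
... | no k≮n  = contradiction (Fin.toℕ<n k) k≮n

extend-out : ∀ {A : Set} {n} (f : Fin n → A) g {i} → ¬ i < n → extend f g i ≡ g i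
extend-out {n = n} f g {i} i≮n with i <? n
... | yes i<n = contradiction i<n i≮n
... | no _    = refl

-- π together with the plain fixed points n, n + 1, …
position : ∀ {n} → B n → ℕ → ℕ
position π = extend (λ k → toℕ ∣ letter π k ∣) id

barred : ∀ {n} → B n → ℕ → Bool
barred π = extend (λ k → isBarred (letter π k)) (λ _ → false)

involution-letter : ∀ {n} (π : B n) → IsInvolution π → ∀ k →
  ∣ letter π ∣ letter π k ∣ ∣ ≡ k × isBarred (letter π ∣ letter π k ∣) ≡ isBarred (letter π k)
involution-letter π inv k with inv k
... | inj₁ eq rewrite eq | eq = refl , refl
... | inj₂ (inj₁ eq) rewrite eq | eq = refl , refl
... | inj₂ (inj₂ (inj₁ (l , _ , eq , eq′))) rewrite eq | eq′ = refl , refl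
... | inj₂ (inj₂ (inj₂ (l , _ , eq , eq′))) rewrite eq | eq′ = refl , refl

position-barred : ∀ {n} (π : B n) → IsInvolution π → ∀ i →
  position π (position π i) ≡ i × barred π (position π i) ≡ barred π i
position-barred {n} π inv i with i <? n
... | no i≮n = extend-out _ _ i≮n , extend-out _ _ i≮n
... | yes i<n with involution-letter π inv (fromℕ< i<n)
...   | eq , eq′ =
  trans (extend-in _ _ ∣ letter π (fromℕ< i<n) ∣) (trans (cong toℕ eq) (Fin.toℕ-fromℕ< i<n)) ,
  trans (extend-in _ _ ∣ letter π (fromℕ< i<n) ∣) eq′

position-< : ∀ {n} (π : B n) j → j < n → position π j < n
position-< {n} π j j<n with j <? n
... | yes p   = Fin.toℕ<n ∣ letter π (fromℕ< p) ∣
... | no j≮n = contradiction j<n j≮n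

M-entryAt : ∀ {n} (π : B n) k l → M π k l ≡ entryAt (isBarred (letter π k)) (toℕ ∣ letter π k ∣) (toℕ l)
M-entryAt π k l with letter π k ≟ˡ plain l | letter π k ≟ˡ bar l
... | yes eq | _      rewrite eq = sym (entryAt-≡ false {toℕ l} refl)
... | no _   | yes eq rewrite eq = sym (entryAt-≡ true {toℕ l} refl)
... | no ≢p  | no ≢b  = sym (entryAt-≢ _ (other (letter π k) ≢p ≢b ∘ Fin.toℕ-injective))
  where
  other : ∀ x → x ≢ plain l → x ≢ bar l → ∣ x ∣ ≢ l
  other (plain _) ≢p ≢b refl = ≢p refl
  other (bar _)   ≢p ≢b refl = ≢b refl

M-extended : ∀ {n} (π : B n) k l → M π k l ≡ entryAt (barred π (toℕ k)) (position π (toℕ k)) (toℕ l)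
M-extended π k l = trans (M-entryAt π k l)
  (sym (cong₂ (λ b p → entryAt b p (toℕ l)) (extend-in _ _ k) (extend-in _ _ k)))

-- Counting barred two-cycles by finite sums

indicator : ∀ {P : Set} → Dec P → ℕ
indicator P? = if does P? then 1 else 0

indicator-yes : ∀ {P : Set} (P? : Dec P) → P → indicator P? ≡ 1
indicator-yes P? p rewrite dec-true P? p = refl

indicator-no : ∀ {P : Set} (P? : Dec P) → ¬ P → indicator P? ≡ 0
indicator-no P? ¬p rewrite dec-false P? ¬p = refl

length-filter-sum : ∀ {A : Set} {P : A → Set} (P? : ∀ x → Dec (P x)) xs →
                    length (filter P? xs) ≡ sum (map (λ x → indicator (P? x)) xs)
length-filter-sum P? []       = refl
length-filter-sum P? (x ∷ xs) with does (P? x)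
... | true  = cong suc (length-filter-sum P? xs)
... | false = length-filter-sum P? xs

sum-cartesianProduct : ∀ {A : Set} (f : A × A → ℕ) xs ys →
  sum (map f (cartesianProduct xs ys)) ≡ sum (map (λ x → sum (map (λ y → f (x , y)) ys)) xs)
sum-cartesianProduct f []       ys = refl
sum-cartesianProduct f (x ∷ xs) ys =
  trans (cong sum (map-++ f (map (x ,_) ys) _))
  (trans (sum-++ (map f (map (x ,_) ys)) _)
    (cong₂ _+_ (cong sum (sym (map-∘ ys))) (sum-cartesianProduct f xs ys)))

sumBelow-suc : ∀ n f → sumBelow (suc n) f ≡ f 0 + sumBelow n (f ∘ suc)
sumBelow-suc zero    f = +-comm 0 (f 0)
sumBelow-suc (suc n) f = trans (cong (_+ f (suc n)) (sumBelow-suc n f)) (+-assoc (f 0) _ _)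

sumBelow-cong : ∀ n {f g} → (∀ j → j < n → f j ≡ g j) → sumBelow n f ≡ sumBelow n g
sumBelow-cong zero    eq = refl
sumBelow-cong (suc n) eq = cong₂ _+_ (sumBelow-cong n λ j j<n → eq j (m<n⇒m<1+n j<n)) (eq n ≤-refl)

sum-allFin : ∀ n {f : Fin n → ℕ} {g : ℕ → ℕ} → (∀ k → f k ≡ g (toℕ k)) →
             sum (map f (allFin n)) ≡ sumBelow n g
sum-allFin n {f} {g} eq = trans (cong sum (map-tabulate id f)) (go n f g eq)
  where
  go : ∀ n (f : Fin n → ℕ) g → (∀ k → f k ≡ g (toℕ k)) → sum (tabulate f) ≡ sumBelow n g
  go zero    f g eq = refl
  go (suc n) f g eq =
    trans (cong₂ _+_ (eq zero) (go n (f ∘ suc) (g ∘ suc) (eq ∘ suc))) (sym (sumBelow-suc n g))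

sumBelow-+ : ∀ n f g → sumBelow n (λ j → f j + g j) ≡ sumBelow n f + sumBelow n g
sumBelow-+ zero    f g = refl
sumBelow-+ (suc n) f g rewrite sumBelow-+ n f g = interchange (sumBelow n f) (sumBelow n g) (f n) (g n)
  where
  interchange : ∀ a b c d → a + b + (c + d) ≡ a + c + (b + d)
  interchange = solve-∀

sumBelow-zero : ∀ n → sumBelow n (λ _ → 0) ≡ 0
sumBelow-zero zero    = refl
sumBelow-zero (suc n) = cong (_+ 0) (sumBelow-zero n)

sumBelow-exchange : ∀ m n (f : ℕ → ℕ → ℕ) →
  sumBelow m (λ i → sumBelow n (f i)) ≡ sumBelow n (λ j → sumBelow m (λ i → f i j))
sumBelow-exchange zero    n f = sym (sumBelow-zero n)
sumBelow-exchange (suc m) n f =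
  trans (cong (_+ sumBelow n (f m)) (sumBelow-exchange m n f)) (sym (sumBelow-+ n _ (f m)))

sumBelow-restrict : ∀ l n f → l ≤ n → sumBelow n (λ k → indicator (k <? l) * f k) ≡ sumBelow l f
sumBelow-restrict zero zero    f l≤n = refl
sumBelow-restrict l    (suc n) f l≤n with l ≟ suc n
... | yes refl = sumBelow-cong (suc n) λ k k<l →
  trans (cong (_* f k) (indicator-yes (k <? suc n) k<l)) (*-identityˡ (f k))
... | no l≢1+n =
  trans (cong₂ _+_ (sumBelow-restrict l n f l≤n′) (cong (_* f n) (indicator-no (n <? l) (≤⇒≯ l≤n′))))
        (+-identityʳ _)
  where
  l≤n′ : l ≤ n
  l≤n′ = s≤s⁻¹ (≤∧≢⇒< l≤n l≢1+n)

negative-M : ∀ {n} (π : B n) k l → negative (M π k l) ≡ indicator (letter π k ≟ˡ bar l)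
negative-M π k l with letter π k ≟ˡ plain l | letter π k ≟ˡ bar l
... | yes eq | yes eq′ with () ← trans (sym eq) eq′
... | yes _  | no _  = refl
... | no _   | yes _ = refl
... | no _   | no _  = refl

-- Of the four kinds of letters of an involution, only those in a barred two-cycle are barred and
-- away from their own position.
barred-transpose : ∀ {n} (π : B n) → IsInvolution π → ∀ {k l} → k ≢ l →
                   letter π l ≡ bar k → letter π k ≡ bar l
barred-transpose π inv {k} {l} k≢l eq with inv l
... | inj₁ eq′ with () ← trans (sym eq) eq′
... | inj₂ (inj₁ eq′) with refl ← trans (sym eq) eq′ = contradiction refl k≢l
... | inj₂ (inj₂ (inj₁ (_ , _ , eq′ , _))) with () ← trans (sym eq) eq′
... | inj₂ (inj₂ (inj₂ (_ , _ , eq′ , eq″))) with refl ← trans (sym eq) eq′ = eq″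

-- One of the two entries decides about the cycle; the one in row `l`, the larger index, is chosen
-- because it lies below the diagonal.
twoCycle-indicator : ∀ {n} (π : B n) → IsInvolution π → ∀ k l →
  indicator ((k Fin.<? l) ×-dec isBarredTwoCycle? π k l) ≡ indicator (toℕ k <? toℕ l) * negative (M π l k)
twoCycle-indicator π inv k l = trans lhs
  (sym (cong (indicator (toℕ k <? toℕ l) *_) (negative-M π l k)))
  where
  cycle? = (k Fin.<? l) ×-dec isBarredTwoCycle? π k l
  lhs : indicator cycle? ≡ indicator (toℕ k <? toℕ l) * indicator (letter π l ≟ˡ bar k)
  lhs = by-cases (toℕ k <? toℕ l) (letter π l ≟ˡ bar k)
    where
    by-cases : (lt? : Dec (toℕ k < toℕ l)) (bar? : Dec (letter π l ≡ bar k)) →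
               indicator cycle? ≡ indicator lt? * indicator bar?
    by-cases (no k≮l)  _        = indicator-no cycle? (k≮l ∘ proj₁)
    by-cases (yes k<l) (no ≢b)  = indicator-no cycle? (≢b ∘ proj₂ ∘ proj₂ ∘ proj₂)
    by-cases (yes k<l) (yes eq) = indicator-yes cycle? (k<l , k≢l , barred-transpose π inv k≢l eq , eq)
      where
      k≢l : k ≢ l
      k≢l = <⇒≢ k<l ∘ cong toℕ

-- The insertion tableau and its sign

module Insertion (r : Fin 2) {n : ℕ} (π : B n) (inv : IsInvolution π) where

  open Growth (toℕ r) (position π) (barred π)
    (proj₁ ∘ position-barred π inv) (proj₂ ∘ position-barred π inv)

  growth≡G : ∀ i j (i≤n : i ≤ n) (j≤n : j ≤ n) → growth (toℕ r) π i j i≤n j≤n ≡ G i j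
  growth≡G zero    j       _   _   = refl
  growth≡G (suc i) zero    _   _   = refl
  growth≡G (suc i) (suc j) i<n j<n
    rewrite growth≡G i j (<⇒≤ i<n) (<⇒≤ j<n) | growth≡G (suc i) j i<n (<⇒≤ j<n)
          | growth≡G i (suc j) (<⇒≤ i<n) j<n =
    cong (λ e → localRule e (G i j) (G (suc i) j) (G i (suc j)))
      (trans (M-extended π (fromℕ< i<n) (fromℕ< j<n)) (cong₂ m (Fin.toℕ-fromℕ< i<n) (Fin.toℕ-fromℕ< j<n)))

  steps : ∀ j → j < n → Step (G n j) (G n (suc j))
  steps j j<n = edge-moved (position-< π j j<n) (edge-right n j)

  -- Taken from `growth` rather than from `G`, so that `IsInsertionTableau` holds by reflexivity.
  insertionChain : Fin (suc n) → Shape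
  insertionChain k = growth (toℕ r) π n (toℕ k) ≤-refl (Fin.toℕ≤pred[n] k)

  insertionChain≡G : ∀ k → insertionChain k ≡ G n (toℕ k)
  insertionChain≡G k = growth≡G n (toℕ k) ≤-refl (Fin.toℕ≤pred[n] k)

  insertionChain-inject₁ : ∀ (k : Fin n) → insertionChain (inject₁ k) ≡ G n (toℕ k)
  insertionChain-inject₁ k = trans (insertionChain≡G (inject₁ k)) (cong (G n) (Fin.toℕ-inject₁ k))

  isDomino-step : ∀ {s t} → Step s t → IsDomino (t ╱ s)
  isDomino-step {s} (step (hor k) f refl) = subst IsDomino (sym (╱-add (hor k) s f)) (horizontal k (row s k))
  isDomino-step {s} (step (ver k) f refl) = subst IsDomino (sym (╱-add (ver k) s f)) (vertical k (row s k))

  tableau : SDT (toℕ r) n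
  tableau = record
    { chain       = insertionChain
    ; isPartition = λ k → subst IsPartition (sym (insertionChain≡G k)) (partition n (toℕ k))
    ; start       = trans (insertionChain≡G zero) (G-left n)
    ; increasing  = λ k {c} → subst₂ (λ s t → c ∈ cells s → c ∈ cells t)
                                (sym (insertionChain-inject₁ k)) (sym (insertionChain≡G (suc k)))
                                (step-⊆ (steps (toℕ k) (Fin.toℕ<n k)))
    ; isDomino    = λ k → subst₂ (λ s t → IsDomino (t ╱ s))
                            (sym (insertionChain-inject₁ k)) (sym (insertionChain≡G (suc k)))
                            (isDomino-step (steps (toℕ k) (Fin.toℕ<n k)))
    }

  barredTwoCycles≡ : barredTwoCycles π ≡ lowerNegatives n
  barredTwoCycles≡ = begin
    barredTwoCycles π
      ≡⟨ length-filter-sum (λ (k , l) → (k Fin.<? l) ×-dec isBarredTwoCycle? π k l)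
                            (cartesianProduct (allFin n) (allFin n)) ⟩
    sum (map w (cartesianProduct (allFin n) (allFin n)))
      ≡⟨ sum-cartesianProduct w (allFin n) (allFin n) ⟩
    sum (map (λ k → sum (map (λ l → w (k , l)) (allFin n))) (allFin n))
      ≡⟨ sum-allFin n (λ k → sum-allFin n (λ l → weight k l)) ⟩
    sumBelow n (λ k → sumBelow n (λ l → indicator (k <? l) * negative (m l k)))
      -- The pairs are grouped by their smaller member `k`, while `lowerNegatives` sums over the
      -- rows `l`.
      ≡⟨ sumBelow-exchange n n _ ⟩
    sumBelow n (λ l → sumBelow n (λ k → indicator (k <? l) * negative (m l k)))
      ≡⟨ sumBelow-cong n (λ l l<n → sumBelow-restrict l n (negative ∘ m l) (<⇒≤ l<n)) ⟩
    lowerNegatives n ∎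
    where
    open ≡-Reasoning
    w : Fin n × Fin n → ℕ
    w (k , l) = indicator ((k Fin.<? l) ×-dec isBarredTwoCycle? π k l)
    weight : ∀ k l → w (k , l) ≡ indicator (toℕ k <? toℕ l) * negative (m (toℕ l) (toℕ k))
    weight k l = trans (twoCycle-indicator π inv k l)
      (cong (λ e → indicator (toℕ k <? toℕ l) * negative e) (M-extended π l k))

  sign-tableau : sign r tableau ≡ -1ℤ ^ barredTwoCycles π
  sign-tableau = trans (Sign.sign-evenVerticals r tableau (G n) insertionChain≡G steps)
    (cong (-1ℤ ^_) (trans (evenVerticalsRow n (position-< π)) (sym barredTwoCycles≡)))

theorem4p4 : (r : Fin 2) (n : ℕ) (π : B n) → IsInvolution π →
    (d : ℕ) → barredTwoCycles π ≡ d →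
    Σ[ D ∈ SDT (toℕ r) n ] (IsInsertionTableau π D × sign r D ≡ -1ℤ ^ d)
theorem4p4 r n π inv _ refl = tableau , (λ _ → refl) , sign-tableau
  where open Insertion r π inv
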